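{- Let $G$ be a VPT graph and let $h\geq 3$. If $G$ is a minimal non $[h,2,1]$ graph with split partition $(S,K)$, then: (i) $|N(k)\cap S|=2$ for every $k\in K$; (ii) $|E(B(G/K))|=|K|$; (iii) $B(G/K)$ is $(h+1)$-critical.
   Context: All graphs are finite, simple and connected. A VPT representation of $G$ is a tree $T$ together with paths $(P_v)_{v\in V(G)}$ of $T$ such that $uv\in E(G)$ iff $P_u$ and $P_v$ share a vertex; $G$ is VPT if it has one. $[h,2,1]$ is the class of graphs admitting a VPT representation whose host tree has maximum degree at most $h$. A minimal non $[h,2,1]$ graph is a graph $G\notin[h,2,1]$ with $G-v\in[h,2,1]$ for all $v\in V(G)$. A graph is split if $V(G)$ can be partitioned into a stable set $S$ and a clique $K$ (split partition $(S,K)$). For a clique $C$ of $G$, the branch graph $B(G/C)$ has as vertices the vertices of $V(G)\setminus C$ adjacent to some vertex of $C$, and $v,w$ are adjacent in $B(G/C)$ iff $vw\notin E(G)$, some $x\in C$ is adjacent to both, some $y\in C$ is adjacent to $v$ but not $w$, and some $z\in C$ is adjacent to $w$ but not $v$. A graph $H$ with chromatic number $k$ is $k$-critical if $\chi(H-v)<k$ for every vertex $v$ and $\chi(H-e)<k$ for every edge $e$. -}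

module Defs where

open import Data.Nat using (ℕ; zero; suc; _≤_; _<_; _<ᵇ_)
open import Data.Bool using (Bool; true; false; _∧_; _∨_; not)
open import Data.Fin using (Fin; toℕ; punchIn; _≟_)
open import Data.List using (List; []; _∷_; _++_; [_]; length; filterᵇ; allFin; cartesianProduct)
open import Data.Bool.ListAction using (any)
open import Data.List.Membership.Propositional using (_∈_)
open import Data.List.Relation.Unary.Linked using (Linked)
open import Data.List.Relation.Unary.Unique.Propositional using (Unique)
open import Data.Product using (Σ; ∃; _×_; _,_; proj₁; proj₂)
open import Data.Unit using (⊤)
open import Data.Empty using (⊥)
open import Relation.Binary.PropositionalEquality using (_≡_; _≢_)
open import Relation.Nullary using (¬_)
open import Relation.Nullary.Decidable using (⌊_⌋)
open import Function.Bundles using (_⇔_)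

record Graph (n : ℕ) : Set where
  field
    adj    : Fin n → Fin n → Bool
    sym    : ∀ u v → adj u v ≡ adj v u
    irrefl : ∀ v → adj v v ≡ false

module _ {n : ℕ} (G : Graph n) where
  open Graph G

  Adj : Fin n → Fin n → Set
  Adj u v = adj u v ≡ true

  data Walk : Fin n → Fin n → Set where
    here : ∀ {u} → Walk u u
    step : ∀ {u w v} → Adj u w → Walk w v → Walk u v

  Connected : Set
  Connected = ∀ u v → Walk u v

  IsPath : List (Fin n) → Set
  IsPath xs = (xs ≢ []) × Unique xs × Linked Adj xs

  IsCycle : List (Fin n) → Set
  IsCycle [] = ⊥
  IsCycle (x ∷ xs) = (2 ≤ length xs) × Unique (x ∷ xs) × Linked Adj ((x ∷ xs) ++ [ x ])

  Acyclic : Set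
  Acyclic = ∀ xs → ¬ IsCycle xs

  IsTree : Set
  IsTree = (1 ≤ n) × Connected × Acyclic

  degree : Fin n → ℕ
  degree x = length (filterᵇ (adj x) (allFin n))

  MaxDegree≤ : ℕ → Set
  MaxDegree≤ h = ∀ x → degree x ≤ h

  neighboursIn : (Fin n → Bool) → Fin n → ℕ
  neighboursIn p k = length (filterᵇ (λ x → adj k x ∧ p x) (allFin n))

record VPTRep {n : ℕ} (G : Graph n) : Set where
  field
    m       : ℕ
    host    : Graph m
    isTree  : IsTree host
    P       : Fin n → List (Fin m)
    isPath  : ∀ v → IsPath host (P v)
    correct : ∀ u v → u ≢ v → (Adj G u v ⇔ ∃ λ x → x ∈ P u × x ∈ P v)

IsVPT : ∀ {n} → Graph n → Set
IsVPT G = VPTRep G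

In[_,2,1] : ℕ → ∀ {n} → Graph n → Set
In[ h ,2,1] G = Σ (VPTRep G) λ R → MaxDegree≤ (VPTRep.host R) h

deleteVertex : ∀ {m} → Graph (suc m) → Fin (suc m) → Graph m
deleteVertex G v = record
  { adj    = λ x y → Graph.adj G (punchIn v x) (punchIn v y)
  ; sym    = λ x y → Graph.sym G (punchIn v x) (punchIn v y)
  ; irrefl = λ x → Graph.irrefl G (punchIn v x)
  }

AllDeletionsIn[_,2,1] : ℕ → ∀ {n} → Graph n → Set
AllDeletionsIn[ h ,2,1] {zero}  G = ⊤
AllDeletionsIn[ h ,2,1] {suc m} G = ∀ v → In[ h ,2,1] (deleteVertex G v)

MinimalNon[_,2,1] : ℕ → ∀ {n} → Graph n → Set
MinimalNon[ h ,2,1] G = ¬ In[ h ,2,1] G × AllDeletionsIn[ h ,2,1] G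

IsSplitPartition : ∀ {n} → Graph n → (Fin n → Bool) → Set
IsSplitPartition G inK =
  (∀ u v → u ≢ v → inK u ≡ false → inK v ≡ false → Graph.adj G u v ≡ false) ×
  (∀ u v → u ≢ v → inK u ≡ true  → inK v ≡ true  → Graph.adj G u v ≡ true)

-- A graph given by a vertex subset V of Fin n and an edge predicate E
-- (only edges between vertices of V count).
record SubGraph (n : ℕ) : Set where
  field
    V : Fin n → Bool
    E : Fin n → Fin n → Bool

_==_ : ∀ {n} → Fin n → Fin n → Bool
x == y = ⌊ x ≟ y ⌋

branchGraph : ∀ {n} → Graph n → (Fin n → Bool) → SubGraph n
branchGraph {n} G inC = record
  { V = λ v → not (inC v) ∧ any (λ x → inC x ∧ adj x v) (allFin n)
  ; E = λ v w → not (adj v w)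
              ∧ any (λ x → inC x ∧ adj x v ∧ adj x w) (allFin n)
              ∧ any (λ y → inC y ∧ adj y v ∧ not (adj y w)) (allFin n)
              ∧ any (λ z → inC z ∧ adj z w ∧ not (adj z v)) (allFin n)
  }
  where open Graph G

module _ {n : ℕ} (H : SubGraph n) where
  open SubGraph H

  numEdges : ℕ
  numEdges = length (filterᵇ (λ p → (toℕ (proj₁ p) <ᵇ toℕ (proj₂ p))
                                    ∧ V (proj₁ p) ∧ V (proj₂ p) ∧ E (proj₁ p) (proj₂ p))
                             (cartesianProduct (allFin n) (allFin n)))

  Colorable : ℕ → Set
  Colorable k = Σ (Fin n → Fin k) λ c →
    ∀ u v → V u ≡ true → V v ≡ true → E u v ≡ true → c u ≢ c v

  ChromaticNumber≡ : ℕ → Set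
  ChromaticNumber≡ k = Colorable k × (∀ j → j < k → ¬ Colorable j)

  ChromaticNumber< : ℕ → Set
  ChromaticNumber< k = Σ ℕ λ j → j < k × Colorable j

  deleteV : Fin n → SubGraph n
  deleteV v = record { V = λ x → V x ∧ not (x == v) ; E = E }

  deleteE : Fin n → Fin n → SubGraph n
  deleteE u v = record { V = V ; E = λ x y → E x y ∧ not ((x == u ∧ y == v) ∨ (x == v ∧ y == u)) }

IsCritical : ℕ → ∀ {n} → SubGraph n → Set
IsCritical k H =
  ChromaticNumber≡ H k ×
  (∀ v → SubGraph.V H v ≡ true → ChromaticNumber< (deleteV H v) k) ×
  (∀ u v → SubGraph.V H u ≡ true → SubGraph.V H v ≡ true → SubGraph.E H u v ≡ true →
     ChromaticNumber< (deleteE H u v) k)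

size : ∀ {n} → (Fin n → Bool) → ℕ
size {n} p = length (filterᵇ p (allFin n))

{-# OPTIONS --safe #-}

-- Fix a representation. By the Helly property the paths of the clique share a host vertex q, and
-- each of them enters at most two of the branches at q. Stable vertices in the same branch with a
-- common neighbour have nested neighbourhoods. Conversely, such an assignment of the stable
-- vertices to h ≥ 3 branches yields a representation on a tree of degree at most h: order the
-- stable vertices by decreasing neighbourhood and let each clique vertex k trace, in its two
-- branches, the word saying to which of them k is adjacent, in a binary tree.
--
-- Such an assignment exists as soon as the stable vertices with maximal neighbourhoods can be
-- properly h-coloured in the branch graph. By minimality all neighbourhoods are then maximal, so
-- every clique vertex has at most two stable neighbours, and two stable vertices are adjacent in
-- the branch graph exactly when they have a common neighbour. No stable vertex has fewer than
-- three branch graph neighbours, for a colouring without it would extend to it. So deleting a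
-- clique vertex k loses no edge of the branch graph but those whose only common neighbour is k,
-- and as an h-colouring is gained, there is exactly one such edge, determining k.
module Submission where

open import Defs
open import Axiom.UniquenessOfIdentityProofs using (module Decidable⇒UIP)
open import Data.Nat as ℕ using (ℕ; zero; suc; _+_; _∸_; _≤_; _<_; _<?_; _≡ᵇ_; z≤n; s≤s; ⌊_/2⌋)
open import Data.Nat.Induction using (<-wellFounded)
open import Data.Nat.Properties as ℕₚ
  using (≤-refl; ≤-trans; ≤-decTotalOrder; <-trans; <-irrefl; <-asym; ≡ᵇ⇒≡; ≡⇒≡ᵇ)
open import Data.Bool as Bool using (Bool; true; false; _∧_; _∨_; not; T?; if_then_else_)
open import Data.Bool.ListAction using (any)
open import Data.Bool.Properties using (T-≡; not-injective; ∧-conicalˡ; ∧-conicalʳ; ∨-comm; ∨-zeroʳ)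
open import Data.Empty using (⊥-elim)
open import Data.Fin as Fin
  using (Fin; zero; suc; toℕ; fromℕ<; inject≤; punchIn; punchOut; _≟_)
open import Data.Fin.Induction using (spo-noetherian)
open import Data.Fin.Properties as Finₚ
  using (all?; any?; ¬∀⟶∃¬; toℕ<n; toℕ-fromℕ<; toℕ-injective; inject≤-injective;
         punchIn-injective; punchIn-punchOut; suc-injective)
open import Data.List
  using (List; []; _∷_; _++_; [_]; length; lookup; map; filterᵇ; allFin; upTo; cartesianProduct)
open import Data.List.Membership.Propositional using (_∈_; _∉_)
open import Data.List.Membership.Propositional.Properties
  using (∈-∃++; ∈-++⁺ˡ; ∈-++⁺ʳ; ∈-++⁻; ∈-map⁺; ∈-map⁻; ∈-filter⁺; ∈-filter⁻; ∈-allFin; ∈-upTo⁺;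
         ∈-cartesianProduct⁺)
import Data.List.Membership.DecPropositional as DecMembership
open import Data.List.Properties
  using (++-assoc; map-++; length-map; length-upTo; length-filter; length-tabulate;
         length-++-sucʳ; ∷-injectiveˡ; map-cong-local)
open import Data.List.Relation.Binary.Permutation.Propositional using (↭-sym)
open import Data.List.Relation.Binary.Permutation.Propositional.Properties using (∈-resp-↭)
open import Data.List.Relation.Unary.All as All using (All; []; _∷_)
import Data.List.Relation.Unary.All.Properties as Allₚ
open import Data.List.Relation.Unary.AllPairs using (AllPairs; []; _∷_)
open import Data.List.Relation.Unary.Any using (here; there; index)
open import Data.List.Relation.Unary.Any.Properties using (lookup-index)
open import Data.List.Relation.Unary.Linked as Linked using (Linked; []; [-]; _∷_)
import Data.List.Relation.Unary.Linked.Properties as Linkedₚ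
open import Data.List.Relation.Unary.Sorted.TotalOrder.Properties using (Sorted⇒AllPairs)
open import Data.List.Relation.Unary.Unique.Propositional using (Unique)
import Data.List.Relation.Unary.Unique.Propositional.Properties as Uniqueₚ
import Data.List.Sort as Sort
open import Data.Product using (Σ; ∃; ∃-syntax; _×_; _,_; proj₁; proj₂)
open import Data.Sum as Sum using (_⊎_; inj₁; inj₂; [_,_]′)
open import Data.Unit using (⊤; tt)
open import Function using (_∘_; id)
open import Function.Bundles using (Equivalence; _⇔_; mk⇔)
open import Induction.WellFounded using (Acc; acc)
open import Relation.Binary using (DecTotalOrder; IsStrictPartialOrder; tri<; tri≈; tri>)
import Relation.Binary.Construct.On as On
open import Relation.Binary.PropositionalEquality
  using (_≡_; _≢_; refl; sym; trans; cong; cong₂; subst; resp₂; isEquivalence; ≢-sym)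
open import Relation.Nullary using (¬_; Dec; yes; no; contradiction; ¬?; _×-dec_; _→-dec_)
open import Relation.Nullary.Decidable using (⌊_⌋)
open import Relation.Unary using (Decidable)

-- Linked and repetition-free lists

module _ {A : Set} {R : A → A → Set} where

  linked-++ˡ : ∀ xs {ys} → Linked R (xs ++ ys) → Linked R xs
  linked-++ˡ []           _       = []
  linked-++ˡ (_ ∷ [])     _       = [-]
  linked-++ˡ (_ ∷ _ ∷ xs) (r ∷ l) = r ∷ linked-++ˡ (_ ∷ xs) l

  linked-++ʳ : ∀ xs {ys} → Linked R (xs ++ ys) → Linked R ys
  linked-++ʳ []       l = l
  linked-++ʳ (_ ∷ xs) l = linked-++ʳ xs (Linked.tail l)

module _ {A : Set} where

  unique-∷ : ∀ {x : A} {xs} → x ∉ xs → Unique xs → Unique (x ∷ xs)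
  unique-∷ x∉ u = Allₚ.¬Any⇒All¬ _ x∉ ∷ u

  unique-split : ∀ xs {z : A} {ys} → Unique (xs ++ z ∷ ys) →
    z ∉ xs × z ∉ ys × (∀ {x} → x ∈ xs → x ∉ ys)
  unique-split []       (z∉ ∷ _) = (λ ()) , (λ z∈ → All.lookup z∉ z∈ refl) , λ ()
  unique-split (x ∷ xs) (x∉ ∷ u) with unique-split xs u
  ... | z∉xs , z∉ys , disj
    = (λ { (here e)  → All.lookup x∉ (∈-++⁺ʳ xs (here refl)) (sym e)
         ; (there p) → z∉xs p })
    , z∉ys
    , (λ { (here refl) p → All.lookup x∉ (∈-++⁺ʳ xs (there p)) refl
         ; (there p)     → disj p })

-- Walks, separation and the Helly property in acyclic graphs

module _ {m : ℕ} (H : Graph m) where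

  -- All vertices of the walk, both ends included, satisfy `Q`. With `Q = (_≢ x)` this is
  -- reachability after the deletion of `x`.
  data Reach (Q : Fin m → Set) : Fin m → Fin m → Set where
    stop : ∀ {u} → Q u → Reach Q u u
    step : ∀ {u w v} → Q u → Adj H u w → Reach Q w v → Reach Q u v

  adj-sym : ∀ {u v} → Adj H u v → Adj H v u
  adj-sym {u} {v} = trans (Graph.sym H v u)

  walk-reach : ∀ {u v} → Walk H u v → Reach (λ _ → ⊤) u v
  walk-reach here       = stop tt
  walk-reach (step a w) = step tt a (walk-reach w)

  module _ {Q : Fin m → Set} where

    reach-start : ∀ {u v} → Reach Q u v → Q u
    reach-start (stop q)     = q
    reach-start (step q _ _) = q

    reach-mono : ∀ {Q′ : Fin m → Set} → (∀ {x} → Q x → Q′ x) →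
      ∀ {u v} → Reach Q u v → Reach Q′ u v
    reach-mono f (stop q)     = stop (f q)
    reach-mono f (step q a r) = step (f q) a (reach-mono f r)

    reach-trans : ∀ {u v w} → Reach Q u v → Reach Q v w → Reach Q u w
    reach-trans (stop _)     s = s
    reach-trans (step q a r) s = step q a (reach-trans r s)

    reach-sym : ∀ {u v} → Reach Q u v → Reach Q v u
    reach-sym (stop q)     = stop q
    reach-sym (step q a r) =
      reach-trans (reach-sym r) (step (reach-start r) (adj-sym a) (stop q))

  module _ {Q : Fin m → Set} where

    -- The walk is cut behind its last vertex in `C`, if it has one; what remains avoids `C`.
    last-exit : ∀ {C : Fin m → Set} → Decidable C → ∀ {u v} → Reach Q u v → ¬ C v →
      Reach (λ x → Q x × ¬ C x) u v ⊎
      (∃[ g ] ∃[ g′ ] C g × Adj H g g′ × Reach (λ x → Q x × ¬ C x) g′ v)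
    last-exit C? (stop q) ¬c = inj₁ (stop (q , ¬c))
    last-exit C? (step {u} q a r) ¬c with last-exit C? r ¬c | C? u
    ... | inj₂ e | _      = inj₂ e
    ... | inj₁ s | yes cu = inj₂ (_ , _ , cu , a , s)
    ... | inj₁ s | no ¬cu = inj₁ (step (q , ¬cu) a s)

    exit : ∀ {g v} → Reach Q g v → g ≢ v →
      ∃[ g′ ] Adj H g g′ × Reach (λ x → Q x × x ≢ g) g′ v
    exit {g} r g≢v with last-exit (_≟ g) r (g≢v ∘ sym)
    ... | inj₁ s = contradiction refl (proj₂ (reach-start s))
    ... | inj₂ (_ , g′ , refl , a , s) = g′ , a , s

  data SimplePath (Q : Fin m → Set) : Fin m → Fin m → List (Fin m) → Set where
    stop : ∀ {v} → Q v → SimplePath Q v v (v ∷ [])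
    step : ∀ {u w v xs} → Q u → Adj H u w → u ∉ xs → SimplePath Q w v xs →
           SimplePath Q u v (u ∷ xs)

  open DecMembership (_≟_ {m}) using (_∈?_)

  module _ {Q : Fin m → Set} where

    cut-at : ∀ {u w v xs} → u ∈ xs → SimplePath Q w v xs → ∃ (SimplePath Q u v)
    cut-at (here refl) p@(stop _)       = _ , p
    cut-at (here refl) p@(step _ _ _ _) = _ , p
    cut-at (there i)   (step _ _ _ p)   = cut-at i p

    loop-erase : ∀ {u v} → Reach Q u v → ∃ (SimplePath Q u v)
    loop-erase (stop q) = _ , stop q
    loop-erase (step {u} q a r) with loop-erase r
    ... | xs , p with u ∈? xs
    ...   | yes i = cut-at i p
    ...   | no u∉ = _ , step q a u∉ p

    simple-all : ∀ {u v xs} → SimplePath Q u v xs → All Q xs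
    simple-all (stop q)       = q ∷ []
    simple-all (step q _ _ p) = q ∷ simple-all p

    simple-unique : ∀ {u v xs} → SimplePath Q u v xs → Unique xs
    simple-unique (stop _)       = [] ∷ []
    simple-unique (step _ _ u∉ p) = unique-∷ u∉ (simple-unique p)

    simple-linked : ∀ {u v xs x y} → Adj H x u → Adj H v y → SimplePath Q u v xs →
      Linked (Adj H) (x ∷ xs ++ [ y ])
    simple-linked a b (stop _)       = a ∷ b ∷ [-]
    simple-linked a b (step _ c _ p) = a ∷ simple-linked c b p

    simple-length : ∀ {u v xs} → u ≢ v → SimplePath Q u v xs → 2 ≤ length xs
    simple-length u≢v (stop _)                    = contradiction refl u≢v
    simple-length _   (step _ _ _ (stop _))       = s≤s (s≤s z≤n)
    simple-length _   (step _ _ _ (step _ _ _ _)) = s≤s (s≤s z≤n)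

  list-reach-from-head : ∀ {x y xs} → Linked (Adj H) (x ∷ xs) → y ∈ x ∷ xs →
    Reach (_∈ x ∷ xs) x y
  list-reach-from-head _       (here refl) = stop (here refl)
  list-reach-from-head (a ∷ l) (there i)   =
    step (here refl) a (reach-mono there (list-reach-from-head l i))

  list-reach : ∀ {xs x y} → Linked (Adj H) xs → x ∈ xs → y ∈ xs → Reach (_∈ xs) x y
  list-reach {_ ∷ _} l i j =
    reach-trans (reach-sym (list-reach-from-head l i)) (list-reach-from-head l j)

  Separates : Fin m → Fin m → Fin m → Set
  Separates x a y = ¬ Reach (_≢ x) a y

  module Acyc (acyclic : Acyclic H) where

    -- Two distinct neighbours of `x` joined by a simple path off `x` would close a cycle through
    -- `x`.
    no-detour : ∀ {x y y′} → Adj H x y → Adj H x y′ → Reach (_≢ x) y y′ → y ≡ y′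
    no-detour {x} {y} {y′} a b r with y ≟ y′
    ... | yes e = e
    ... | no ≢ with loop-erase r
    ...   | xs , p = ⊥-elim (acyclic (x ∷ xs)
              ( simple-length ≢ p
              , All.map (λ z≢x x≡z → z≢x (sym x≡z)) (simple-all p) ∷ simple-unique p
              , simple-linked a (adj-sym b) p))

    before : ∀ L {x M a} → Linked (Adj H) (L ++ x ∷ M) → a ∈ L →
      ∃[ p ] p ∈ L × Adj H p x × Reach (_∈ L) a p
    before (y ∷ [])     (e ∷ _) (here refl) = y , here refl , e , stop (here refl)
    before (y ∷ y′ ∷ L) (e ∷ l) (here refl) with before (y′ ∷ L) l (here refl)
    ... | p , i , ep , r = p , there i , ep , step (here refl) e (reach-mono there r)
    before (y ∷ y′ ∷ L) (e ∷ l) (there j) with before (y′ ∷ L) l j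
    ... | p , i , ep , r = p , there i , ep , reach-mono there r

    after : ∀ {x M y} → Linked (Adj H) (x ∷ M) → y ∈ M →
      ∃[ n ] n ∈ M × Adj H x n × Reach (_∈ M) n y
    after (e ∷ l) i = _ , here refl , e , list-reach-from-head l i

    -- A walk around `x` would join the predecessor and the successor of `x` on the path, so these
    -- would coincide, although the path has no repetition.
    path-separates : ∀ L {x M a y} → Linked (Adj H) (L ++ x ∷ M) → Unique (L ++ x ∷ M) →
      a ∈ L → y ∈ M → Separates x a y
    path-separates L {x} {M} l u i j r
      with before L l i | after (linked-++ʳ L l) j | unique-split L u
    ... | p , p∈ , ep , rp | n , n∈ , en , rn | x∉L , x∉M , disj =
      disj p∈ (subst (_∈ M) (sym p≡n) n∈)
      where
      p≡n : p ≡ n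
      p≡n = no-detour (adj-sym ep) en
        (reach-trans (reach-sym (reach-mono (λ { i refl → x∉L i }) rp))
          (reach-trans r (reach-sym (reach-mono (λ { i refl → x∉M i }) rn))))

    private
      from-head : ∀ {a L u v} → Linked (Adj H) (a ∷ L) → Unique (a ∷ L) →
        u ∈ L → v ∈ L → u ≢ v → Separates u a v ⊎ Separates v a u
      from-head {a} {L} {u} {v} l un i j u≢v with ∈-∃++ i
      ... | M , N , refl with ∈-++⁻ M j
      ...   | inj₂ (here v≡u) = contradiction (sym v≡u) u≢v
      ...   | inj₂ (there j′) = inj₁ (path-separates (a ∷ M) l un (here refl) j′)
      ...   | inj₁ j′ with ∈-∃++ j′
      ...     | M₁ , M₂ , refl = inj₂ (path-separates (a ∷ M₁)
                  (subst (Linked _) eq l) (subst Unique eq un)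
                  (here refl) (∈-++⁺ʳ M₂ (here refl)))
        where
        eq : a ∷ (M₁ ++ v ∷ M₂) ++ u ∷ N ≡ (a ∷ M₁) ++ v ∷ M₂ ++ u ∷ N
        eq = cong (a ∷_) (++-assoc M₁ (v ∷ M₂) (u ∷ N))

    -- Leading vertices are dropped until one of the three is the head. Of the other two, the
    -- earlier then separates the head from the later.
    one-separates : ∀ {L x y z} → Linked (Adj H) L → Unique L → x ∈ L → y ∈ L → z ∈ L →
      x ≢ y → y ≢ z → z ≢ x → Separates z x y ⊎ Separates x z y ⊎ Separates y z x
    one-separates l u (here refl) (here refl) _ x≢y _ _ = contradiction refl x≢y
    one-separates l u (here refl) (there _) (here refl) _ _ z≢x = contradiction refl z≢x
    one-separates l u (there _) (here refl) (here refl) _ y≢z _ = contradiction refl y≢z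
    one-separates l u (here refl) (there j) (there k) _ y≢z _ =
      [ inj₂ ∘ inj₂ ∘ (_∘ reach-sym) , inj₁ ]′ (from-head l u j k y≢z)
    one-separates l u (there i) (here refl) (there k) _ _ z≢x =
      [ inj₁ ∘ (_∘ reach-sym) , inj₂ ∘ inj₁ ∘ (_∘ reach-sym) ]′ (from-head l u k i z≢x)
    one-separates l u (there i) (there j) (here refl) x≢y _ _ =
      inj₂ (from-head l u i j x≢y)
    one-separates l (_ ∷ u) (there i) (there j) (there k) =
      one-separates (Linked.tail l) u i j k

    -- Removing `q` cuts the path into two connected pieces, and two of three vertices fall into the
    -- same piece.
    two-sides : ∀ {L q x y z} → Linked (Adj H) L → Unique L → q ∈ L →
      x ∈ L → y ∈ L → z ∈ L → x ≢ q → y ≢ q → z ≢ q →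
      Reach (_≢ q) x y ⊎ Reach (_≢ q) x z ⊎ Reach (_≢ q) y z
    two-sides {q = q} l un iq ix iy iz x≢ y≢ z≢ with ∈-∃++ iq
    ... | A , B , refl = go (side ix x≢) (side iy y≢) (side iz z≢)
      where
      side : ∀ {x} → x ∈ A ++ q ∷ B → x ≢ q → x ∈ A ⊎ x ∈ B
      side i x≢q with ∈-++⁻ A i
      ... | inj₁ j         = inj₁ j
      ... | inj₂ (here e)  = contradiction e x≢q
      ... | inj₂ (there j) = inj₂ j
      inA : ∀ {x y} → x ∈ A → y ∈ A → Reach (_≢ q) x y
      inA i j = reach-mono (λ { i refl → proj₁ (unique-split A un) i })
                  (list-reach (linked-++ˡ A l) i j)
      inB : ∀ {x y} → x ∈ B → y ∈ B → Reach (_≢ q) x y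
      inB i j = reach-mono (λ { i refl → proj₁ (proj₂ (unique-split A un)) i })
                  (list-reach (Linked.tail (linked-++ʳ A l)) i j)
      go : ∀ {x y z} → x ∈ A ⊎ x ∈ B → y ∈ A ⊎ y ∈ B → z ∈ A ⊎ z ∈ B →
        Reach (_≢ q) x y ⊎ Reach (_≢ q) x z ⊎ Reach (_≢ q) y z
      go (inj₁ i) (inj₁ j) _        = inj₁ (inA i j)
      go (inj₂ i) (inj₂ j) _        = inj₁ (inB i j)
      go (inj₁ i) (inj₂ _) (inj₁ k) = inj₂ (inj₁ (inA i k))
      go (inj₂ i) (inj₁ _) (inj₂ k) = inj₂ (inj₁ (inB i k))
      go (inj₁ _) (inj₂ j) (inj₂ k) = inj₂ (inj₂ (inB j k))
      go (inj₂ _) (inj₁ j) (inj₁ k) = inj₂ (inj₂ (inA j k))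

    module _ {I : Set} (P : I → List (Fin m))
      (connected : Connected H) (linked : ∀ i → Linked (Adj H) (P i)) (z₀ : Fin m) where

      -- If the common part C of the earlier paths misses P i, leave C for P i through an edge g g′;
      -- some earlier path P j misses g′, and going from g′ along P i and P j to g closes a cycle.
      helly : ∀ is → (∀ {i j} → i ∈ is → j ∈ is → ∃[ x ] x ∈ P i × x ∈ P j) →
        ∃[ q ] All (λ i → q ∈ P i) is
      helly []       _     = z₀ , []
      helly (i ∷ is) meets with helly is (λ a b → meets (there a) (there b))
      ... | a , a∈C with meets (here refl) (here refl)
      ...   | p , p∈Pi , _ with All.all? (λ j → p ∈? P j) is
      ...     | yes p∈C = p , p∈Pi ∷ p∈C
      ...     | no p∉C with last-exit (λ x → All.all? (λ j → x ∈? P j) is)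
                              (walk-reach (connected a p)) p∉C
      ...       | inj₁ r = contradiction a∈C (proj₂ (reach-start r))
      ...       | inj₂ (g , g′ , g∈C , e , r) with g ∈? P i
      ...         | yes g∈Pi = g , g∈Pi ∷ g∈C
      ...         | no g∉Pi = ⊥-elim (Allₚ.All¬⇒¬Any (All.tabulate impossible)
                                (Allₚ.¬All⇒Any¬ (λ j → g′ ∈? P j) is (proj₂ (reach-start r))))
        where
        impossible : ∀ {j} → j ∈ is → ¬ (g′ ∉ P j)
        impossible {j} j∈ g′∉ with meets (here refl) (there j∈)
        ... | z , z∈Pi , z∈Pj with exit (list-reach (linked j) (All.lookup g∈C j∈) z∈Pj)
                                     (λ { refl → g∉Pi z∈Pi })
        ...   | g″ , e′ , r′ = g′∉ (subst (_∈ P j) (sym g′≡g″) (proj₁ (reach-start r′)))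
          where
          g′≡g″ : g′ ≡ g″
          g′≡g″ = no-detour e e′
            (reach-trans (reach-mono (λ { (_ , ∉C) refl → ∉C g∈C }) r)
            (reach-trans (reach-mono (λ { p∈ refl → g∉Pi p∈ }) (list-reach (linked i) p∈Pi z∈Pi))
              (reach-sym (reach-mono proj₂ r′))))

-- Branches around the centre of a representation

module _ {A : Set} (p : A → Bool) where

  ∈-filterᵇ⁺ : ∀ {x xs} → x ∈ xs → p x ≡ true → x ∈ filterᵇ p xs
  ∈-filterᵇ⁺ i e = ∈-filter⁺ (T? ∘ p) i (Equivalence.from T-≡ e)

  ∈-filterᵇ⁻ : ∀ {x xs} → x ∈ filterᵇ p xs → x ∈ xs × p x ≡ true
  ∈-filterᵇ⁻ {xs = xs} i with ∈-filter⁻ (T? ∘ p) {xs = xs} i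
  ... | j , t = j , Equivalence.to T-≡ t

adj? : ∀ {n} (G : Graph n) u v → Dec (Adj G u v)
adj? G u v = Graph.adj G u v Bool.≟ true

_⊑[_]_ : ∀ {n} → Fin n → Graph n → Fin n → Set
s ⊑[ G ] t = ∀ k → Adj G s k → Adj G t k

-- The combinatorial trace of a representation around a vertex of the host tree common to all
-- clique paths: the branches containing the paths of the stable vertices, h of them in all.
record Branching {n} (G : Graph n) (Q : Fin n → Set) (h : ℕ) : Set where
  field
    branch : Fin n → Fin h
    nested : ∀ {s t k} → Q s → Q t → Adj G s k → Adj G t k → branch s ≡ branch t →
             s ⊑[ G ] t ⊎ t ⊑[ G ] s
    two    : ∀ {s t u k} → Q s → Q t → Q u → Adj G s k → Adj G t k → Adj G u k →
             branch s ≡ branch t ⊎ branch s ≡ branch u ⊎ branch t ≡ branch u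

module _ {n} (G : Graph n) (inK : Fin n → Bool) where

  -- The path of a stable vertex joined to the whole clique may contain the common vertex of the
  -- clique paths, and then it lies in no branch.
  Incomplete : Fin n → Set
  Incomplete s = inK s ≡ false × ∃[ k ] inK k ≡ true × ¬ Adj G s k

  module _ (split : IsSplitPartition G inK) where

    stable-adj : ∀ {s k} → inK s ≡ false → Adj G s k → inK k ≡ true
    stable-adj {s} {k} es a with inK k in ek | s ≟ k
    ... | true  | _        = refl
    ... | false | yes refl with () ← trans (sym a) (Graph.irrefl G s)
    ... | false | no s≢k   with () ← trans (sym a) (proj₁ split s k s≢k es ek)

    K≢S : ∀ {k s} → inK k ≡ true → inK s ≡ false → k ≢ s
    K≢S ek es refl with () ← trans (sym ek) es

    module _ (R : VPTRep G) {h} (maxDegree : MaxDegree≤ (VPTRep.host R) (suc h)) where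
      open VPTRep R
      open Acyc host (proj₂ (proj₂ isTree))
      open DecMembership (_≟_ {m}) using (_∈?_)

      private
        connected = proj₁ (proj₂ isTree)

        linked : ∀ v → _
        linked v = proj₂ (proj₂ (isPath v))

        unique : ∀ v → _
        unique v = proj₁ (proj₂ (isPath v))

        point : ∀ v → ∃ (_∈ P v)
        point v with P v | proj₁ (isPath v)
        ... | []    | ≢[] = contradiction refl ≢[]
        ... | x ∷ _ | _   = x , here refl

        meets : ∀ {u v} → u ≢ v → Adj G u v → ∃ λ x → x ∈ P u × x ∈ P v
        meets {u} {v} u≢v = Equivalence.to (correct u v u≢v)

        joined : ∀ {u v x} → u ≢ v → x ∈ P u → x ∈ P v → Adj G u v
        joined {u} {v} u≢v i j = Equivalence.from (correct u v u≢v) (_ , i , j)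

        a-vertex : ∀ {m} → 1 ≤ m → Fin m
        a-vertex (s≤s _) = zero

        centre : ∃[ q ] (∀ {k} → inK k ≡ true → q ∈ P k)
        centre with helly P connected linked (a-vertex (proj₁ isTree))
                      (filterᵇ inK (allFin n)) meet
          where
          meet : ∀ {i j} → i ∈ filterᵇ inK (allFin n) → j ∈ filterᵇ inK (allFin n) →
            ∃[ x ] x ∈ P i × x ∈ P j
          meet {i} {j} i∈ j∈ with i ≟ j
          ... | yes refl = let x , x∈ = point i in x , x∈ , x∈
          ... | no i≢j   = meets i≢j (proj₂ split i j i≢j
                             (proj₂ (∈-filterᵇ⁻ inK {xs = allFin n} i∈))
                             (proj₂ (∈-filterᵇ⁻ inK {xs = allFin n} j∈)))
        ... | q , all = q , λ {k} ek → All.lookup all (∈-filterᵇ⁺ inK (∈-allFin k) ek)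

        q = proj₁ centre

        q∈ : ∀ {k} → inK k ≡ true → q ∈ P k
        q∈ = proj₂ centre

        door : ∀ {x} → q ≢ x → ∃[ y ] Adj host q y × Reach host (_≢ q) y x
        door {x} q≢x with exit host (walk-reach host (connected q x)) q≢x
        ... | y , a , r = y , a , reach-mono host proj₂ r

        entry : ∀ {x} (q≢x : q ≢ x) → Adj host q (proj₁ (door q≢x))
        entry q≢x = proj₁ (proj₂ (door q≢x))

        through : ∀ {x} (q≢x : q ≢ x) → Reach host (_≢ q) (proj₁ (door q≢x)) x
        through q≢x = proj₂ (proj₂ (door q≢x))

        neighbours = filterᵇ (Graph.adj host q) (allFin m)

        number : ∀ {y} → Adj host q y → Fin (suc h)
        number {y} a =
          inject≤ (index (∈-filterᵇ⁺ (Graph.adj host q) (∈-allFin y) a)) (maxDegree q)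

        number-cong : ∀ {y z} (a : Adj host q y) (b : Adj host q z) → y ≡ z → number a ≡ number b
        -- The number is computed from the proof of adjacency, which is unique, being an equality of
        -- booleans.
        number-cong a b refl = cong number (Decidable⇒UIP.≡-irrelevant Bool._≟_ a b)

        number-injective : ∀ {y z} (a : Adj host q y) (b : Adj host q z) →
          number a ≡ number b → y ≡ z
        number-injective {y} {z} a b e =
          trans (lookup-index iy) (trans (cong (lookup neighbours)
            (inject≤-injective (maxDegree q) (maxDegree q) _ _ e)) (sym (lookup-index iz)))
          where
          iy = ∈-filterᵇ⁺ (Graph.adj host q) (∈-allFin y) a
          iz = ∈-filterᵇ⁺ (Graph.adj host q) (∈-allFin z) b

        direction : Fin m → Fin (suc h)
        direction x with q ≟ x
        -- A dummy value, for which the number of branches is of the form `suc h`: the facts about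
        -- `direction` only concern vertices other than `q`.
        ... | yes _  = zero
        ... | no q≢x = number (entry q≢x)

        direction-sound : ∀ {x y} → q ≢ x → q ≢ y → direction x ≡ direction y →
          Reach host (_≢ q) x y
        direction-sound {x} {y} q≢x q≢y e with q ≟ x | q ≟ y
        ... | yes p | _     = contradiction p q≢x
        ... | no _  | yes p = contradiction p q≢y
        ... | no a  | no b = reach-trans host (reach-sym host (through a))
          (subst (λ z → Reach host (_≢ q) z y)
            (sym (number-injective (entry a) (entry b) e)) (through b))

        direction-complete : ∀ {x y} → q ≢ x → q ≢ y → Reach host (_≢ q) x y →
          direction x ≡ direction y
        direction-complete {x} {y} q≢x q≢y r with q ≟ x | q ≟ y
        ... | yes p | _     = contradiction p q≢x
        ... | no _  | yes p = contradiction p q≢y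
        ... | no a  | no b = number-cong (entry a) (entry b) (no-detour (entry a) (entry b)
          (reach-trans host (through a) (reach-trans host r (reach-sym host (through b)))))

        -- A path through `q` meets every clique path, also that of the clique vertex not adjacent
        -- to `s`.
        avoids : ∀ {s} → Incomplete s → ∀ {x} → x ∈ P s → q ≢ x
        avoids (es , k , ek , ¬a) i refl = ¬a (joined (K≢S ek es ∘ sym) i (q∈ ek))

        direction-const : ∀ {s} → Incomplete s → ∀ {x y} → x ∈ P s → y ∈ P s →
          direction x ≡ direction y
        direction-const {s} Is i j = direction-complete (avoids Is i) (avoids Is j)
          (reach-mono host (λ i → avoids Is i ∘ sym) (list-reach host (linked s) i j))

        path-direction : ∀ {s} → Incomplete s → ∀ {x} → x ∈ P s →
          direction x ≡ direction (proj₁ (point s))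
        path-direction {s} Is i = direction-const Is i (proj₂ (point s))

        disjoint : ∀ {s t} → inK s ≡ false → inK t ≡ false → s ≢ t →
          ∀ {x} → x ∈ P s → x ∉ P t
        disjoint es et s≢t i j with () ← trans (sym (joined s≢t i j)) (proj₁ split _ _ s≢t es et)

        -- The path of a neighbour `k` of `t` runs from `q` to the path of `t`. If it missed `x`,
        -- following it and then the path of `t`, which is disjoint from that of `s`, would lead
        -- from `q` to `y` around `x`.
        dominated : ∀ {s t x y} → inK s ≡ false → inK t ≡ false → s ≢ t → x ∈ P s → y ∈ P t →
          Separates host x q y → t ⊑[ G ] s
        dominated {s} {t} {x} {y} es et s≢t x∈ y∈ sep k a
          with meets (K≢S (stable-adj et a) et ∘ sym) a | x ∈? P k
        ... | z , z∈t , z∈k | yes x∈k = joined (K≢S (stable-adj et a) es ∘ sym) x∈ x∈k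
        ... | z , z∈t , z∈k | no x∉k = ⊥-elim (sep (reach-trans host
                (reach-mono host (λ { i refl → x∉k i })
                  (list-reach host (linked k) (q∈ (stable-adj et a)) z∈k))
                (reach-mono host (λ { i refl → disjoint es et s≢t x∈ i })
                  (list-reach host (linked t) z∈t y∈))))

      branching : Branching G Incomplete (suc h)
      branching = record
        { branch = λ v → direction (proj₁ (point v))
        ; nested = nested
        ; two    = two
        }
        where
        nested : ∀ {s t k} → Incomplete s → Incomplete t → Adj G s k → Adj G t k →
          direction (proj₁ (point s)) ≡ direction (proj₁ (point t)) →
          s ⊑[ G ] t ⊎ t ⊑[ G ] s
        nested {s} {t} {k} Is It as at e with s ≟ t
        ... | yes refl = inj₁ (λ _ → id)
        ... | no s≢t with meets (K≢S (stable-adj (proj₁ Is) as) (proj₁ Is) ∘ sym) as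
                        | meets (K≢S (stable-adj (proj₁ It) at) (proj₁ It) ∘ sym) at
        ...   | x , x∈s , x∈k | y , y∈t , y∈k
          -- The points `x`, `y` and `q` all lie on the path of `k`. The middle one cannot be `q`,
          -- because `x` and `y` are in the same branch; if it is `x` or `y`, `dominated` applies.
          with one-separates (linked k) (unique k) x∈k y∈k (q∈ (stable-adj (proj₁ Is) as))
                 (λ { refl → disjoint (proj₁ Is) (proj₁ It) s≢t x∈s y∈t })
                 (avoids It y∈t ∘ sym) (avoids Is x∈s)
        ...     | inj₁ sep = ⊥-elim (sep (direction-sound (avoids Is x∈s) (avoids It y∈t)
                    (trans (path-direction Is x∈s) (trans e (sym (path-direction It y∈t))))))
        ...     | inj₂ (inj₁ sep) =
                    inj₂ (dominated (proj₁ Is) (proj₁ It) s≢t x∈s y∈t sep)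
        ...     | inj₂ (inj₂ sep) =
                    inj₁ (dominated (proj₁ It) (proj₁ Is) (s≢t ∘ sym) y∈t x∈s sep)

        two : ∀ {s t u k} → Incomplete s → Incomplete t → Incomplete u →
          Adj G s k → Adj G t k → Adj G u k →
          direction (proj₁ (point s)) ≡ direction (proj₁ (point t)) ⊎
          direction (proj₁ (point s)) ≡ direction (proj₁ (point u)) ⊎
          direction (proj₁ (point t)) ≡ direction (proj₁ (point u))
        two {s} {t} {u} {k} Is It Iu as at au
          with on Is as | on It at | on Iu au
          where
          on : ∀ {s} → Incomplete s → Adj G s k → ∃[ x ] x ∈ P s × x ∈ P k
          on Is as = meets (K≢S (stable-adj (proj₁ Is) as) (proj₁ Is) ∘ sym) as
        ... | x , x∈s , x∈k | y , y∈t , y∈k | z , z∈u , z∈k =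
          Sum.map (same Is It x∈s y∈t) (Sum.map (same Is Iu x∈s z∈u) (same It Iu y∈t z∈u))
            (two-sides (linked k) (unique k) (q∈ (stable-adj (proj₁ Is) as))
              x∈k y∈k z∈k (avoids Is x∈s ∘ sym) (avoids It y∈t ∘ sym) (avoids Iu z∈u ∘ sym))
          where
          same : ∀ {s t x y} → Incomplete s → Incomplete t → x ∈ P s → y ∈ P t →
            Reach host (_≢ q) x y → direction (proj₁ (point s)) ≡ direction (proj₁ (point t))
          same Is It i j r = trans (sym (path-direction Is i))
            (trans (direction-complete (avoids Is i) (avoids It j) r) (path-direction It j))

-- Any map without fixed points would serve.
other : ∀ {h} → Fin (suc (suc h)) → Fin (suc (suc h))
other zero    = suc zero
other (suc _) = zero

other-≢ : ∀ {h} (x : Fin (suc (suc h))) → x ≢ other x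
other-≢ zero    ()
other-≢ (suc _) ()

-- Recolouring by maximal neighbourhoods

module Maximality {n} (G : Graph n) (inK : Fin n → Bool) where

  Stable : Fin n → Set
  Stable s = inK s ≡ false

  infix 4 _⊑_ _⊏_

  _⊑_ : Fin n → Fin n → Set
  s ⊑ t = s ⊑[ G ] t

  _⊑?_ : ∀ s t → Dec (s ⊑ t)
  s ⊑? t = all? (λ k → adj? G s k →-dec adj? G t k)

  -- Stable vertices with equal neighbourhoods are ordered by their index, so that exactly one
  -- of them is maximal.
  _⊏_ : Fin n → Fin n → Set
  s ⊏ t = s ⊑ t × (t ⊑ s → t Fin.< s) × Stable t

  _⊏?_ : ∀ s t → Dec (s ⊏ t)
  s ⊏? t = (s ⊑? t) ×-dec ((t ⊑? s) →-dec (t Fin.<? s)) ×-dec (inK t Bool.≟ false)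

  ⊏-isStrictPartialOrder : IsStrictPartialOrder _≡_ _⊏_
  ⊏-isStrictPartialOrder = record
    { isEquivalence = isEquivalence
    ; irrefl        = λ { refl (_ , lt , _) → Finₚ.<-irrefl refl (lt (λ _ → id)) }
    ; trans         = λ { (st , lt , _) (tu , lu , q) →
                          (λ k → tu k ∘ st k)
                        , (λ us → Finₚ.<-trans (lu (λ k → st k ∘ us k)) (lt (λ k → us k ∘ tu k)))
                        , q }
    ; <-resp-≈      = resp₂ _⊏_
    }

  Maximal : Fin n → Set
  Maximal s = Stable s × ∀ t → ¬ (s ⊏ t)

  maximal? : ∀ s → Dec (Maximal s)
  maximal? s = (inK s Bool.≟ false) ×-dec all? (λ t → ¬? (s ⊏? t))

  -- Climbing along `⊏` terminates, since a strict order on a finite set is noetherian.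
  maximal-above : ∀ {s} → Stable s → ∃[ ρ ] Maximal ρ × s ⊑ ρ
  maximal-above {s} q = go q (spo-noetherian ⊏-isStrictPartialOrder s)
    where
    go : ∀ {s} → Stable s → Acc (λ x y → y ⊏ x) s → ∃[ ρ ] Maximal ρ × s ⊑ ρ
    go {s} q (acc rec) with any? (s ⊏?_)
    ... | no ¬∃ = s , (q , λ t lt → ¬∃ (t , lt)) , λ _ → id
    ... | yes (t , lt@(st , _ , qt)) with go qt (rec lt)
    ...   | ρ , max , tρ = ρ , max , λ k → tρ k ∘ st k

  -- If the inclusion were strict, the index condition in `⊏` would hold vacuously and `t` would
  -- exceed `ρ`.
  maximal-⊑ : ∀ {ρ t} → Maximal ρ → Stable t → ρ ⊑ t → t ⊑ ρ
  maximal-⊑ {ρ} {t} (_ , max) qt ρt with t ⊑? ρ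
  ... | yes tρ = tρ
  ... | no ¬tρ = contradiction (ρt , (λ tρ → contradiction tρ ¬tρ) , qt) (max t)

  -- The neighbourhoods are equal, so the vertex of smaller index would exceed the other one.
  maximal-antisym : ∀ {ρ ρ′} → Maximal ρ → Maximal ρ′ → ρ ⊑ ρ′ → ρ ≡ ρ′
  maximal-antisym {ρ} {ρ′} m m′ le with Finₚ.<-cmp ρ ρ′
  ... | tri≈ _ e _ = e
  ... | tri< lt _ _ = contradiction (maximal-⊑ m (proj₁ m′) le , (λ _ → lt) , proj₁ m) (proj₂ m′ ρ)
  ... | tri> _ _ gt = contradiction (le , (λ _ → gt) , proj₁ m′) (proj₂ m ρ′)

  module _ {H} (B : Branching G Stable H) where
    open Branching B renaming (branch to b)

    maximal-branch : ∀ {ρ t k} → Maximal ρ → Stable t → Adj G t k → Adj G ρ k → b t ≡ b ρ → t ⊑ ρ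
    maximal-branch m qt at aρ e with nested qt (proj₁ m) at aρ e
    ... | inj₁ le = le
    ... | inj₂ ge = maximal-⊑ m qt ge

    maximal-unique : ∀ {ρ ρ′ k} → Maximal ρ → Maximal ρ′ → Adj G ρ k → Adj G ρ′ k →
      b ρ ≡ b ρ′ → ρ ≡ ρ′
    maximal-unique m m′ a a′ e = maximal-antisym m m′ (maximal-branch m′ (proj₁ m) a a′ e)

    module Recolour {h} (c : Fin n → Fin (suc (suc h)))
      (proper : ∀ {ρ ρ′ k} → Maximal ρ → Maximal ρ′ → ρ ≢ ρ′ → Adj G ρ k → Adj G ρ′ k →
                c ρ ≢ c ρ′) where

      -- Among the maximal vertices above `s`, one in the branch of `s` is preferred, whenever there
      -- is one.
      Above : Fin n → Fin n → Set
      Above s ρ = Maximal ρ × s ⊑ ρ ×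
        (∀ ρ′ → Maximal ρ′ → s ⊑ ρ′ → b ρ′ ≡ b s → b ρ ≡ b s)

      above : ∀ s → ∃[ ρ ] (Stable s → Above s ρ)
      above s with inK s Bool.≟ false
      ... | no ¬q = s , λ q → contradiction q ¬q
      ... | yes q with any? (λ ρ → maximal? ρ ×-dec (s ⊑? ρ) ×-dec (b ρ ≟ b s))
      ...   | yes (ρ , m , le , e) = ρ , λ _ → m , le , λ _ _ _ _ → e
      ...   | no ¬∃ with maximal-above q
      ...     | ρ , m , le = ρ , λ _ → m , le , λ ρ′ m′ le′ e′ → ⊥-elim (¬∃ (ρ′ , m′ , le′ , e′))

      top : Fin n → Fin n
      top s = proj₁ (above s)

      top-maximal : ∀ {s} → Stable s → Maximal (top s)
      top-maximal {s} q = proj₁ (proj₂ (above s) q)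

      top-⊑ : ∀ {s k} → Stable s → Adj G s k → Adj G (top s) k
      top-⊑ {s} q a = proj₁ (proj₂ (proj₂ (above s) q)) _ a

      top-aligned : ∀ {s ρ} → Stable s → Maximal ρ → s ⊑ ρ → b ρ ≡ b s → b (top s) ≡ b s
      top-aligned {s} {ρ} q m le = proj₂ (proj₂ (proj₂ (above s) q)) ρ m le

      -- Chosen so that stable neighbours of the same clique vertex k get equal colours exactly when
      -- they lie in the same branch: k meets at most two branches, and a vertex off the branch of
      -- the maximal one above it gets a second colour, a function of the colour of the latter.
      colour : Fin n → Fin (suc (suc h))
      colour s with b (top s) ≟ b s
      ... | yes _ = c (top s)
      ... | no _  = other (c (top s))

      -- If `top s` lies in the common branch, it is above `t` as well, so `top t` lies there too
      -- and both coincide. If neither does, both lie in the only other branch met by `k` and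
      -- coincide again.
      branch⇒colour : ∀ {s t k} → Stable s → Stable t → Adj G s k → Adj G t k →
        b s ≡ b t → colour s ≡ colour t
      branch⇒colour {s} {t} {k} qs qt as at e with b (top s) ≟ b s | b (top t) ≟ b t
      ... | yes es | yes et = cong c (maximal-unique (top-maximal qs) (top-maximal qt)
                                (top-⊑ qs as) (top-⊑ qt at) (trans es (trans e (sym et))))
      ... | yes es | no ¬et = contradiction (top-aligned qt (top-maximal qs)
              (maximal-branch (top-maximal qs) qt at (top-⊑ qs as) (trans (sym e) (sym es)))
              (trans es e)) ¬et
      ... | no ¬es | yes et = contradiction (top-aligned qs (top-maximal qt)
              (maximal-branch (top-maximal qt) qs as (top-⊑ qt at) (trans e (sym et)))
              (trans et (sym e))) ¬es
      ... | no ¬es | no ¬et with two (proj₁ (top-maximal qs)) (proj₁ (top-maximal qt)) qs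
                                    (top-⊑ qs as) (top-⊑ qt at) as
      ...   | inj₁ f        = cong (other ∘ c) (maximal-unique (top-maximal qs) (top-maximal qt)
                                (top-⊑ qs as) (top-⊑ qt at) f)
      ...   | inj₂ (inj₁ f) = contradiction f ¬es
      ...   | inj₂ (inj₂ f) = contradiction (trans f e) ¬et

      -- The branches of `s` and `top s` are all that `k` meets. A branch contains at most one
      -- maximal neighbour of `k`, so `top t` is not in that of `top s`.
      misaligned : ∀ {s t k} → Stable s → Stable t → Adj G s k → Adj G t k → b (top s) ≢ b s →
        top s ≢ top t → b s ≡ b (top t)
      misaligned qs qt as at ¬es ¬p
        with two qs (proj₁ (top-maximal qs)) (proj₁ (top-maximal qt)) as (top-⊑ qs as) (top-⊑ qt at)
      ... | inj₁ f        = contradiction (sym f) ¬es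
      ... | inj₂ (inj₁ f) = f
      ... | inj₂ (inj₂ f) = contradiction (maximal-unique (top-maximal qs) (top-maximal qt)
                              (top-⊑ qs as) (top-⊑ qt at) f) ¬p

      colour⇒branch : ∀ {s t k} → Stable s → Stable t → Adj G s k → Adj G t k →
        colour s ≡ colour t → b s ≡ b t
      colour⇒branch {s} {t} {k} qs qt as at e
        with b (top s) ≟ b s | b (top t) ≟ b t | top s ≟ top t
      ... | yes es | yes et | yes p = trans (sym es) (trans (cong b p) et)
      ... | yes _  | yes _  | no ¬p = contradiction e
              (proper (top-maximal qs) (top-maximal qt) ¬p (top-⊑ qs as) (top-⊑ qt at))
      ... | yes _  | no _   | yes p = contradiction (trans (sym (cong c p)) e) (other-≢ _)
      ... | no _   | yes _  | yes p = contradiction (trans (cong c p) (sym e)) (other-≢ _)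
      ... | yes es | no ¬et | no ¬p = trans (sym es) (sym (misaligned qt qs at as ¬et (¬p ∘ sym)))
      ... | no ¬es | yes et | no ¬p = trans (misaligned qs qt as at ¬es ¬p) et
      ... | no ¬es | no ¬et | yes p with two qs qt (proj₁ (top-maximal qs)) as at (top-⊑ qs as)
      ...   | inj₁ f        = f
      ...   | inj₂ (inj₁ f) = contradiction (sym f) ¬es
      ...   | inj₂ (inj₂ f) = contradiction (trans (cong b (sym p)) (sym f)) ¬et
      colour⇒branch {s} {t} {k} qs qt as at e | no ¬es | no ¬et | no ¬p =
        -- Being maximal and in the branch of `s`, `top t` is above `s`, and the preference in
        -- `Above` would have aligned `s`.
        contradiction (top-aligned qs (top-maximal qt)
          (maximal-branch (top-maximal qt) qs as (top-⊑ qt at) f) (sym f)) ¬es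
        where
        f = misaligned qs qt as at ¬es ¬p

      recoloured : Branching G Stable (suc (suc h))
      recoloured = record
        { branch = colour
        ; nested = λ qs qt as at e → nested qs qt as at (colour⇒branch qs qt as at e)
        ; two    = λ qs qt qu as at au → Sum.map (branch⇒colour qs qt as at)
                     (Sum.map (branch⇒colour qs qu as au) (branch⇒colour qt qu at au))
                     (two qs qt qu as at au)
        }

-- Comparing the lengths of lists

length-≤ : ∀ {A B : Set} (R : A → B → Set) {xs : List A} {ys : List B} → Unique xs →
  (∀ {x} → x ∈ xs → ∃[ y ] y ∈ ys × R x y) →
  (∀ {x x′ y} → x ∈ xs → x′ ∈ xs → R x y → R x′ y → x ≡ x′) →
  length xs ≤ length ys
length-≤ R {[]}     {ys} _          _     _   = z≤n
length-≤ R {x ∷ xs} {ys} (x∉ ∷ uxs) total inj with total (here refl)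
... | y , y∈ , r with ∈-∃++ y∈
...   | A , B , refl = subst (suc (length xs) ≤_) (sym (length-++-sucʳ A y B))
          (s≤s (length-≤ R uxs total′ (λ i j → inj (there i) (there j))))
  where
  total′ : ∀ {x′} → x′ ∈ xs → ∃[ y′ ] y′ ∈ A ++ B × R x′ y′
  total′ i with total (there i)
  ... | y′ , y′∈ , r′ with ∈-++⁻ A y′∈
  ...   | inj₁ j            = y′ , ∈-++⁺ˡ j , r′
  ...   | inj₂ (there j)    = y′ , ∈-++⁺ʳ A j , r′
  -- No other element has the partner `y`, so `y` can be removed from the second list.
  ...   | inj₂ (here refl)  = contradiction (inj (here refl) (there i) r r′) (All.lookup x∉ i)

length-⊆ : ∀ {A : Set} {xs ys : List A} → Unique xs → (∀ {x} → x ∈ xs → x ∈ ys) →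
  length xs ≤ length ys
length-⊆ u sub = length-≤ _≡_ u (λ i → _ , sub i , refl) (λ _ _ e e′ → trans e (sym e′))

filterᵇ-unique : ∀ {A : Set} (p : A → Bool) {xs} → Unique xs → Unique (filterᵇ p xs)
filterᵇ-unique p = Uniqueₚ.filter⁺ (Bool.T? ∘ p)

module _ {n : ℕ} (G : Graph n) where

  walk-trans : ∀ {u v w} → Walk G u v → Walk G v w → Walk G u w
  walk-trans here       w′ = w′
  walk-trans (step a w) w′ = step a (walk-trans w w′)

  walk-sym : ∀ {u v} → Walk G u v → Walk G v u
  walk-sym here               = here
  walk-sym (step {u} {w} a r) = walk-trans (walk-sym r) (step (adj-sym G {u} {w} a) here)

-- Rooted host trees

module RootedTree (p : ℕ → ℕ) (p-≤ : ∀ u → p u ≤ u) where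

  -- The vertices are natural numbers, 0 is the root and p u is the parent of suc u.
  data Up : ℕ → ℕ → Set where
    up : ∀ {u} → Up (suc u) (p u)

  Up-< : ∀ {i j} → Up i j → j < i
  Up-< up = s≤s (p-≤ _)

  Up-unique : ∀ {i j k} → Up i j → Up i k → j ≡ k
  Up-unique up up = refl

  Edge : ℕ → ℕ → Set
  Edge i j = Up i j ⊎ Up j i

  upᵇ : ℕ → ℕ → Bool
  upᵇ zero    _ = false
  upᵇ (suc u) j = p u ≡ᵇ j

  upᵇ-sound : ∀ i {j} → upᵇ i j ≡ true → Up i j
  upᵇ-sound (suc u) {j} e with ≡ᵇ⇒≡ (p u) j (Equivalence.from T-≡ e)
  ... | refl = up

  upᵇ-complete : ∀ {i j} → Up i j → upᵇ i j ≡ true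
  upᵇ-complete (up {u}) = Equivalence.to T-≡ (≡⇒≡ᵇ (p u) (p u) refl)

  upᵇ-irrefl : ∀ i → upᵇ i i ≡ false
  upᵇ-irrefl i with upᵇ i i in e
  ... | false = refl
  ... | true  = contradiction (Up-< (upᵇ-sound i e)) (<-irrefl refl)

  graph : ∀ m → Graph m
  graph m = record
    { adj    = λ x y → upᵇ (toℕ x) (toℕ y) ∨ upᵇ (toℕ y) (toℕ x)
    ; sym    = λ x y → ∨-comm (upᵇ (toℕ x) (toℕ y)) _
    ; irrefl = λ x → subst (λ b → b ∨ b ≡ false) (sym (upᵇ-irrefl (toℕ x))) refl
    }

  adj⇒edge : ∀ {m} {x y : Fin m} → Adj (graph m) x y → Edge (toℕ x) (toℕ y)
  adj⇒edge {x = x} {y} e with upᵇ (toℕ x) (toℕ y) in f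
  ... | true  = inj₁ (upᵇ-sound _ f)
  ... | false = inj₂ (upᵇ-sound _ e)

  edge⇒adj : ∀ {m} {x y : Fin m} → Edge (toℕ x) (toℕ y) → Adj (graph m) x y
  edge⇒adj {x = x} {y} (inj₁ u) rewrite upᵇ-complete u = refl
  edge⇒adj {x = x} {y} (inj₂ u) =
    trans (∨-comm (upᵇ (toℕ x) (toℕ y)) _) (cong (_∨ upᵇ (toℕ x) (toℕ y)) (upᵇ-complete u))

  NonBacktracking : List ℕ → Set
  NonBacktracking (x ∷ y ∷ z ∷ L) = x ≢ z × NonBacktracking (y ∷ z ∷ L)
  NonBacktracking _               = ⊤

  -- After a step to a child, a step to the parent would go back to the vertex just left, as parents
  -- are unique.
  descending : ∀ {a b z} L → Linked Edge (a ∷ b ∷ L ++ [ z ]) → NonBacktracking (a ∷ b ∷ L ++ [ z ]) →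
    Up b a → a < z × ∃[ y ] y ∈ b ∷ L × Up z y
  descending [] (_ ∷ inj₁ v ∷ [-]) (a≢z , _) u = contradiction (Up-unique u v) a≢z
  descending [] (_ ∷ inj₂ v ∷ [-]) _ u = <-trans (Up-< u) (Up-< v) , _ , here refl , v
  descending (c ∷ L) (_ ∷ inj₁ v ∷ l) (a≢c , _) u = contradiction (Up-unique u v) a≢c
  descending (c ∷ L) (_ ∷ inj₂ v ∷ l) (_ , nb) u with descending L (inj₂ v ∷ l) nb v
  ... | lt , y , i , w = <-trans (Up-< u) lt , y , there i , w

  -- Either the walk climbs to its end, through falling numbers, or it descends at last and enters
  -- its end from the parent.
  turning : ∀ {a b z} L → Linked Edge (a ∷ b ∷ L ++ [ z ]) → NonBacktracking (a ∷ b ∷ L ++ [ z ]) →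
    z < a ⊎ (∃[ y ] y ∈ b ∷ L × Up z y)
  turning L l@(inj₂ u ∷ _) nb = inj₂ (proj₂ (descending L l nb u))
  turning [] (inj₁ u ∷ inj₁ v ∷ [-]) _ = inj₁ (<-trans (Up-< v) (Up-< u))
  turning [] (inj₁ u ∷ inj₂ v ∷ [-]) _ = inj₂ (_ , here refl , v)
  turning (c ∷ L) (inj₁ u ∷ l) (_ , nb) with turning L l nb
  ... | inj₁ lt = inj₁ (<-trans lt (Up-< u))
  ... | inj₂ (y , i , v) = inj₂ (y , there i , v)

  unique⇒nonBacktracking : ∀ {z} x y L → Unique (x ∷ y ∷ L) → z ∉ x ∷ y ∷ L →
    NonBacktracking (x ∷ y ∷ L ++ [ z ])
  unique⇒nonBacktracking x y []      _ z∉ = (λ e → z∉ (here (sym e))) , tt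
  unique⇒nonBacktracking x y (w ∷ L) (x∉ ∷ u) z∉ =
    All.lookup x∉ (there (here refl)) , unique⇒nonBacktracking y w L u (z∉ ∘ there)

  -- A walk that never backtracks keeps descending once it has descended. So a cycle either is
  -- monotone, or leaves its start upwards and comes back from above, through the same parent.
  no-cycle : ∀ {x y z} L → Unique (x ∷ y ∷ z ∷ L) → ¬ Linked Edge (x ∷ y ∷ z ∷ L ++ [ x ])
  no-cycle {x} {y} {z} L un@(x∉ ∷ u@(y∉ ∷ _)) (e ∷ l) with e
  ... | inj₂ v = <-irrefl refl (proj₁ (descending (z ∷ L) (e ∷ l)
                   (All.lookup x∉ (there (here refl)) , nb) v))
    where nb = unique⇒nonBacktracking y z L u (λ i → All.lookup x∉ i refl)
  ... | inj₁ v with turning L l (unique⇒nonBacktracking y z L u (λ i → All.lookup x∉ i refl))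
  ...   | inj₁ lt          = <-asym lt (Up-< v)
  ...   | inj₂ (w , i , t) = All.lookup y∉ i (Up-unique v t)

  acyclic : ∀ {m} → Acyclic (graph m)
  acyclic (_ ∷ [])     (() , _)
  acyclic (_ ∷ _ ∷ []) (s≤s () , _)
  acyclic (x ∷ y ∷ z ∷ L) (_ , u , l) = no-cycle (map toℕ L) (Uniqueₚ.map⁺ toℕ-injective u)
    (subst (Linked Edge) (map-++ toℕ (x ∷ y ∷ z ∷ L) [ x ]) (Linkedₚ.map⁺ (Linked.map adj⇒edge l)))

  module _ {m : ℕ} where

    to-root : ∀ x → Acc _<_ (toℕ x) → Walk (graph (suc m)) x zero
    to-root zero    _         = here
    to-root (suc x) (acc rec) = step {w = y} (edge⇒adj (inj₁ (subst (Up (suc (toℕ x))) (sym eq) up)))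
        (to-root y (rec (subst (_< suc (toℕ x)) (sym eq) (s≤s (p-≤ _)))))
      where
      bound : p (toℕ x) < suc m
      bound = s≤s (≤-trans (p-≤ _) (ℕₚ.<⇒≤ (toℕ<n x)))
      y : Fin (suc m)
      y = fromℕ< bound
      eq : toℕ y ≡ p (toℕ x)
      eq = toℕ-fromℕ< bound

    isTree : IsTree (graph (suc m))
    isTree = s≤s z≤n
           , (λ u v → walk-trans _ (to-root u (<-wellFounded _))
                         (walk-sym _ (to-root v (<-wellFounded _))))
           , acyclic

  -- This lets paths be handled as lists of natural numbers; bounds are needed only here, where they
  -- are transported to the finite tree.
  representation : ∀ {n} (G : Graph n) m (P : Fin n → List ℕ) →
    (∀ v → All (_< suc m) (P v)) → (∀ v → P v ≢ []) → (∀ v → Unique (P v)) →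
    (∀ v → Linked Edge (P v)) →
    (∀ u v → u ≢ v → Adj G u v ⇔ ∃ λ x → x ∈ P u × x ∈ P v) → VPTRep G
  representation {n} G m P bounded ≢[] uniq linked correct = record
    { m       = suc m
    ; host    = graph (suc m)
    ; isTree  = isTree
    ; P       = P′
    ; isPath  = λ v → nonempty v
                    , Uniqueₚ.map⁻ (subst Unique (sym (P′-toℕ v)) (uniq v))
                    , Linked.map edge⇒adj
                        (Linkedₚ.map⁻ (subst (Linked Edge) (sym (P′-toℕ v)) (linked v)))
    ; correct = λ u v u≢v → mk⇔
        (λ a → let x , i , j = Equivalence.to (correct u v u≢v) a
                   y , k , e = lift u i
               in  y , k , lift′ v (subst (_∈ P v) e j))
        (λ { (y , i , j) → Equivalence.from (correct u v u≢v) (toℕ y , lower u i , lower v j) })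
    }
    where
    bounds : ∀ xs → All (_< suc m) xs → List (Fin (suc m))
    bounds []       []       = []
    bounds (_ ∷ xs) (b ∷ bs) = fromℕ< b ∷ bounds xs bs

    bounds-toℕ : ∀ xs bs → map toℕ (bounds xs bs) ≡ xs
    bounds-toℕ []       []       = refl
    bounds-toℕ (x ∷ xs) (b ∷ bs) rewrite toℕ-fromℕ< b = cong (x ∷_) (bounds-toℕ xs bs)

    P′ : Fin n → List (Fin (suc m))
    P′ v = bounds (P v) (bounded v)

    P′-toℕ : ∀ v → map toℕ (P′ v) ≡ P v
    P′-toℕ v = bounds-toℕ (P v) (bounded v)

    nonempty : ∀ v → P′ v ≢ []
    nonempty v e = ≢[] v (trans (sym (P′-toℕ v)) (cong (map toℕ) e))

    lower : ∀ v {y} → y ∈ P′ v → toℕ y ∈ P v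
    lower v i = subst (_ ∈_) (P′-toℕ v) (∈-map⁺ toℕ i)

    lift : ∀ v {x} → x ∈ P v → ∃[ y ] y ∈ P′ v × x ≡ toℕ y
    lift v i = ∈-map⁻ toℕ (subst (_ ∈_) (sym (P′-toℕ v)) i)

    lift′ : ∀ v {y} → toℕ y ∈ P v → y ∈ P′ v
    lift′ v i with lift v i
    ... | z , j , e = subst (_∈ P′ v) (sym (toℕ-injective e)) j

-- The numbered host tree and its paths

bit : Bool → ℕ
bit false = 0
bit true  = 1

half-double : ∀ β u → ⌊ bit β + (u + u) /2⌋ ≡ u
half-double false u = sym (ℕₚ.n≡⌊n+n/2⌋ u)
half-double true  u = sym (ℕₚ.n≡⌈n+n/2⌉ u)

double-half : ∀ x → ∃[ β ] x ≡ bit β + (⌊ x /2⌋ + ⌊ x /2⌋)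
double-half zero          = false , refl
double-half (suc zero)    = true , refl
double-half (suc (suc x)) with double-half x
... | false , e = false , cong suc (trans (cong suc e) (sym (ℕₚ.+-suc ⌊ x /2⌋ ⌊ x /2⌋)))
... | true  , e = true , cong (λ y → suc (suc y)) (trans e (sym (ℕₚ.+-suc ⌊ x /2⌋ ⌊ x /2⌋)))

-- The infinite tree whose root has h children, every other vertex having two, numbered so that
-- the non-root vertex u is the natural number suc u: the children of the root are those with
-- u < h, and u has the children h + 2u and h + 2u + 1.
module Heap (g : ℕ) where

  h = suc g

  child : ℕ → Bool → ℕ
  child u β = h + (bit β + (u + u))

  parent : ℕ → ℕ
  parent u with u <? h
  ... | yes _ = 0
  ... | no _  = suc ⌊ u ∸ h /2⌋

  parent-≤ : ∀ u → parent u ≤ u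
  parent-≤ u with u <? h
  ... | yes _ = z≤n
  ... | no ≮h with ℕₚ.≮⇒≥ ≮h
  ...   | s≤s {n = v} _ = s≤s (≤-trans (ℕₚ.⌊n/2⌋≤n _) (ℕₚ.m∸n≤m v g))

  open RootedTree parent parent-≤

  parent-root : ∀ {u} → u < h → parent u ≡ 0
  parent-root {u} u<h with u <? h
  ... | yes _ = refl
  ... | no ≮h = contradiction u<h ≮h

  parent-child : ∀ u β → parent (child u β) ≡ suc u
  parent-child u β with child u β <? h
  ... | yes lt = contradiction (ℕₚ.m≤m+n h _) (ℕₚ.<⇒≱ lt)
  ... | no _   = cong suc (trans (cong ⌊_/2⌋ (ℕₚ.m+n∸m≡n h _)) (half-double β u))

  Up-root : ∀ {u} → u < h → Up (suc u) 0
  Up-root lt = subst (Up _) (parent-root lt) up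

  Up-child : ∀ u β → Up (suc (child u β)) (suc u)
  Up-child u β = subst (Up _) (parent-child u β) up

  root-child : ∀ {u} → Up u 0 → u ∈ map suc (upTo h)
  root-child u = go u refl
    where
    go : ∀ {i j} → Up i j → j ≡ 0 → i ∈ map suc (upTo h)
    go (up {u}) e with u <? h
    ... | yes lt = ∈-map⁺ suc (∈-upTo⁺ lt)
    ... | no _ with () ← e

  inner-child : ∀ {i v} → Up i (suc v) → ∃[ β ] i ≡ suc (child v β)
  inner-child u = go u refl
    where
    go : ∀ {i j v} → Up i j → j ≡ suc v → ∃[ β ] i ≡ suc (child v β)
    go (up {u}) e with u <? h
    ... | yes lt with () ← e
    ... | no ≮h with double-half (u ∸ h)
    ...   | β , f with e
    ...     | refl = β , cong suc (trans (sym (ℕₚ.m+[n∸m]≡n (ℕₚ.≮⇒≥ ≮h))) (cong (h +_) f))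

  degree-≤ : 3 ≤ h → ∀ {m} → MaxDegree≤ (graph m) h
  degree-≤ 3≤h {m} x = go (toℕ x) refl
    where
    toℕ-length : ∀ ys → (∀ {j} → Edge (toℕ x) j → j ∈ ys) → degree (graph m) x ≤ length ys
    toℕ-length ys sub = length-≤ (λ y j → toℕ y ≡ j)
      (filterᵇ-unique (Graph.adj (graph m) x) (Uniqueₚ.allFin⁺ m))
      (λ {y} i → toℕ y
         , sub (adj⇒edge (proj₂ (∈-filterᵇ⁻ (Graph.adj (graph m) x) {xs = allFin m} i))) , refl)
      (λ _ _ e e′ → toℕ-injective (trans e (sym e′)))

    go : ∀ i → toℕ x ≡ i → degree (graph m) x ≤ h
    go zero e = subst (degree (graph m) x ≤_) (trans (length-map suc (upTo h)) (length-upTo h))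
      (toℕ-length (map suc (upTo h)) sub)
      where
      sub : ∀ {j} → Edge (toℕ x) j → j ∈ map suc (upTo h)
      sub (inj₁ u) with () ← ℕₚ.<-≤-trans (Up-< u) (ℕₚ.≤-reflexive e)
      sub (inj₂ u) = root-child (subst (Up _) e u)
    -- An inner vertex is adjacent to its parent and to two children, whence `3 ≤ h`.
    go (suc v) e = ≤-trans
      (toℕ-length (parent v ∷ suc (child v false) ∷ suc (child v true) ∷ []) sub) 3≤h
      where
      sub : ∀ {j} → Edge (toℕ x) j → j ∈ parent v ∷ suc (child v false) ∷ suc (child v true) ∷ []
      sub (inj₁ u) = here (Up-unique (subst (λ i → Up i _) e u) up)
      sub (inj₂ u) with inner-child (subst (Up _) e u)
      ... | false , eq = there (here eq)
      ... | true  , eq = there (there (here eq))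

  -- The word is read from its last letter: its tails are the vertices on the way to the root.
  node : Fin h → List Bool → ℕ
  node c []      = toℕ c
  node c (β ∷ w) = child (node c w) β

  child-injective : ∀ {u v β γ} → child u β ≡ child v γ → u ≡ v × β ≡ γ
  child-injective {u} {v} {β} {γ} e with ℕₚ.+-cancelˡ-≡ h _ _ e
  ... | f with trans (sym (half-double β u)) (trans (cong ⌊_/2⌋ f) (half-double γ v))
  ...   | refl = refl , bit-injective (ℕₚ.+-cancelʳ-≡ (u + u) (bit β) (bit γ) f)
    where
    bit-injective : ∀ {β γ} → bit β ≡ bit γ → β ≡ γ
    bit-injective {false} {false} _ = refl
    bit-injective {true}  {true}  _ = refl

  node-injective : ∀ {c d} v w → node c v ≡ node d w → c ≡ d × v ≡ w
  node-injective []      []      e = toℕ-injective e , refl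
  node-injective {c} [] (γ ∷ w) e = contradiction (ℕₚ.<-≤-trans (toℕ<n c) (ℕₚ.m≤m+n h _))
    (ℕₚ.<-irrefl e)
  node-injective {d = d} (β ∷ v) [] e = contradiction (ℕₚ.<-≤-trans (toℕ<n d) (ℕₚ.m≤m+n h _))
    (ℕₚ.<-irrefl (sym e))
  node-injective {c} {d} (β ∷ v) (γ ∷ w) e with child-injective {β = β} {γ} e
  ... | f , refl with node-injective {c} {d} v w f
  ...   | refl , refl = refl , refl

  -- A strict bound for the numbers given to words of length `r`, from which the size of the finite
  -- tree is taken.
  capacity : ℕ → ℕ
  capacity zero    = h
  capacity (suc r) = h + (capacity r + capacity r)

  capacity-mono : ∀ {i j} → i ≤ j → capacity i ≤ capacity j
  capacity-mono {j = zero}  z≤n     = ≤-refl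
  capacity-mono {j = suc j} z≤n     = ℕₚ.m≤m+n h _
  capacity-mono             (s≤s l) = ℕₚ.+-monoʳ-≤ h (ℕₚ.+-mono-≤ (capacity-mono l) (capacity-mono l))

  node-< : ∀ c w → node c w < capacity (length w)
  node-< c []      = toℕ<n c
  node-< c (β ∷ w) = ℕₚ.+-monoʳ-< h (ℕₚ.≤-<-trans (ℕₚ.+-monoˡ-≤ _ (bit-≤ β))
      (ℕₚ.+-mono-≤-< (node-< c w) (node-< c w)))
    where
    bit-≤ : ∀ β → bit β ≤ 1
    bit-≤ false = z≤n
    bit-≤ true  = s≤s z≤n

  -- `ups` climbs from `node c w` to a child of the root and `downs` runs the other way, each
  -- followed by `r`, so that the two can be joined at the root.
  ups : Fin h → List Bool → List ℕ → List ℕ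
  ups c []      r = suc (node c []) ∷ r
  ups c (β ∷ w) r = suc (node c (β ∷ w)) ∷ ups c w r

  downs : Fin h → List Bool → List ℕ → List ℕ
  downs c []      r = suc (node c []) ∷ r
  downs c (β ∷ w) r = downs c w (suc (node c (β ∷ w)) ∷ r)

  On : Fin h → List Bool → ℕ → Set
  On c []      x = x ≡ suc (node c [])
  On c (β ∷ w) x = x ≡ suc (node c (β ∷ w)) ⊎ On c w x

  On-node : ∀ {c} w {x} → On c w x → ∃[ v ] length v ≤ length w × x ≡ suc (node c v)
  On-node []      e        = [] , z≤n , e
  On-node (β ∷ w) (inj₁ e) = β ∷ w , ≤-refl , e
  On-node (β ∷ w) (inj₂ o) with On-node w o
  ... | v , le , e = v , ℕₚ.m≤n⇒m≤1+n le , e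

  On-shorter : ∀ {c d} v w → length w < length v → ¬ On c w (suc (node d v))
  On-shorter v w lt o with On-node w o
  ... | u , le , e with node-injective v u (ℕₚ.suc-injective e)
  ...   | refl , refl = ℕₚ.<⇒≱ lt le

  On-disjoint : ∀ {c d} v w {x} → c ≢ d → On c v x → ¬ On d w x
  On-disjoint v w c≢d o o′ with On-node v o | On-node w o′
  ... | a , _ , refl | b , _ , e = c≢d (proj₁ (node-injective a b (ℕₚ.suc-injective e)))

  On-≢0 : ∀ {c} w → ¬ On c w 0
  On-≢0 w o with On-node w o
  ... | _ , _ , ()

  On-< : ∀ {c} w {x} → On c w x → x < suc (capacity (length w))
  On-< w o with On-node w o
  ... | v , le , refl = s≤s (ℕₚ.<-≤-trans (node-< _ v) (capacity-mono le))

  ∈-ups⁻ : ∀ {c} w {r x} → x ∈ ups c w r → On c w x ⊎ x ∈ r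
  ∈-ups⁻ []      (here e)  = inj₁ e
  ∈-ups⁻ []      (there i) = inj₂ i
  ∈-ups⁻ (β ∷ w) (here e)  = inj₁ (inj₁ e)
  ∈-ups⁻ (β ∷ w) (there i) = Sum.map inj₂ id (∈-ups⁻ w i)

  ∈-ups⁺ : ∀ {c} w {r x} → On c w x ⊎ x ∈ r → x ∈ ups c w r
  ∈-ups⁺ []      (inj₁ e)        = here e
  ∈-ups⁺ []      (inj₂ i)        = there i
  ∈-ups⁺ (β ∷ w) (inj₁ (inj₁ e)) = here e
  ∈-ups⁺ (β ∷ w) (inj₁ (inj₂ o)) = there (∈-ups⁺ w (inj₁ o))
  ∈-ups⁺ (β ∷ w) (inj₂ i)        = there (∈-ups⁺ w (inj₂ i))

  ∈-downs⁻ : ∀ {c} w {r x} → x ∈ downs c w r → On c w x ⊎ x ∈ r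
  ∈-downs⁻ []      (here e)  = inj₁ e
  ∈-downs⁻ []      (there i) = inj₂ i
  ∈-downs⁻ (β ∷ w) i with ∈-downs⁻ w i
  ... | inj₁ o         = inj₁ (inj₂ o)
  ... | inj₂ (here e)  = inj₁ (inj₁ e)
  ... | inj₂ (there j) = inj₂ j

  ∈-downs⁺ : ∀ {c} w {r x} → On c w x ⊎ x ∈ r → x ∈ downs c w r
  ∈-downs⁺ []      (inj₁ e)        = here e
  ∈-downs⁺ []      (inj₂ i)        = there i
  ∈-downs⁺ (β ∷ w) (inj₁ (inj₁ e)) = ∈-downs⁺ w (inj₂ (here e))
  ∈-downs⁺ (β ∷ w) (inj₁ (inj₂ o)) = ∈-downs⁺ w (inj₁ o)
  ∈-downs⁺ (β ∷ w) (inj₂ i)        = ∈-downs⁺ w (inj₂ (there i))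

  ups-linked : ∀ c w {r} → Linked Edge (0 ∷ r) → Linked Edge (ups c w (0 ∷ r))
  ups-linked c []          l = inj₁ (Up-root (toℕ<n c)) ∷ l
  ups-linked c (β ∷ [])    l = inj₁ (Up-child _ β) ∷ ups-linked c [] l
  ups-linked c (β ∷ γ ∷ w) l = inj₁ (Up-child _ β) ∷ ups-linked c (γ ∷ w) l

  downs-linked : ∀ c w {r} → Linked Edge (suc (node c w) ∷ r) → Linked Edge (0 ∷ downs c w r)
  downs-linked c []      l = inj₂ (Up-root (toℕ<n c)) ∷ l
  downs-linked c (β ∷ w) l = downs-linked c w (inj₂ (Up-child _ β) ∷ l)

  ups-unique : ∀ c w {r} → Unique r → (∀ {x} → x ∈ r → ¬ On c w x) → Unique (ups c w r)
  ups-unique c []      u off = unique-∷ (λ i → off i refl) u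
  ups-unique c (β ∷ w) u off =
    unique-∷ (λ i → [ On-shorter (β ∷ w) w ≤-refl , (λ j → off j (inj₁ refl)) ]′ (∈-ups⁻ w i))
             (ups-unique c w u (λ i → off i ∘ inj₂))

  downs-unique : ∀ c w {r} → Unique r → (∀ {x} → x ∈ r → ¬ On c w x) → Unique (downs c w r)
  downs-unique c []      u off = unique-∷ (λ i → off i refl) u
  downs-unique c (β ∷ w) u off = downs-unique c w (unique-∷ (λ i → off i (inj₁ refl)) u)
    λ { (here refl) → On-shorter (β ∷ w) w ≤-refl ; (there i) → off i ∘ inj₂ }

  through-root : Fin h → List Bool → Fin h → List Bool → List ℕ
  through-root c v d w = ups c v (0 ∷ downs d w [])

  through-root⁻ : ∀ {c} v {d} w {x} → x ∈ through-root c v d w → On c v x ⊎ x ≡ 0 ⊎ On d w x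
  through-root⁻ v w i with ∈-ups⁻ v i
  ... | inj₁ o         = inj₁ o
  ... | inj₂ (here e)  = inj₂ (inj₁ e)
  ... | inj₂ (there j) with ∈-downs⁻ w j
  ...   | inj₁ o = inj₂ (inj₂ o)

  through-root⁺ : ∀ {c} v {d} w {x} → On c v x ⊎ x ≡ 0 ⊎ On d w x → x ∈ through-root c v d w
  through-root⁺ v w (inj₁ o)        = ∈-ups⁺ v (inj₁ o)
  through-root⁺ v w (inj₂ (inj₁ e)) = ∈-ups⁺ v (inj₂ (here e))
  through-root⁺ v w (inj₂ (inj₂ o)) = ∈-ups⁺ v (inj₂ (there (∈-downs⁺ w (inj₁ o))))

  through-root-linked : ∀ c v d w → Linked Edge (through-root c v d w)
  through-root-linked c v d w = ups-linked c v (downs-linked d w [-])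

  through-root-unique : ∀ {c d} v w → c ≢ d → Unique (through-root c v d w)
  through-root-unique {c} {d} v w c≢d = ups-unique c v
    (unique-∷ (λ i → [ On-≢0 w , (λ ()) ]′ (∈-downs⁻ w i)) (downs-unique d w [] (λ ())))
    (λ { (here refl) → On-≢0 v
       ; (there i) o → [ On-disjoint v w c≢d o , (λ ()) ]′ (∈-downs⁻ w i) })

  ups-≢[] : ∀ c w {r} → ups c w r ≢ []
  ups-≢[] c []      ()
  ups-≢[] c (_ ∷ _) ()

-- Words read along suffixes of a list

module Suffixes {n : ℕ} where

  from : Fin n → List (Fin n) → List (Fin n)
  from s [] = []
  from s (t ∷ L) with s ≟ t
  ... | yes _ = t ∷ L
  ... | no _  = from s L

  from-length : ∀ s L → length (from s L) ≤ length L
  from-length s [] = z≤n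
  from-length s (t ∷ L) with s ≟ t
  ... | yes _ = ≤-refl
  ... | no _  = ℕₚ.m≤n⇒m≤1+n (from-length s L)

  from-length-injective : ∀ {s t} L → s ∈ L → t ∈ L →
    length (from s L) ≡ length (from t L) → s ≡ t
  from-length-injective {s} {t} (u ∷ L) i j e with s ≟ u | t ≟ u
  ... | yes refl | yes refl = refl
  ... | yes _    | no _     = contradiction (from-length t L) (ℕₚ.<⇒≱ (ℕₚ.≤-reflexive e))
  ... | no _     | yes _    = contradiction (from-length s L) (ℕₚ.<⇒≱ (ℕₚ.≤-reflexive (sym e)))
  from-length-injective {s} {t} (u ∷ L) (here e)  _         _ | no s≢u | _      = contradiction e s≢u
  from-length-injective {s} {t} (u ∷ L) (there _) (here e)  _ | _      | no t≢u = contradiction e t≢u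
  from-length-injective {s} {t} (u ∷ L) (there i) (there j) e | no _   | no _   =
    from-length-injective L i j e

  from-head : ∀ {s} L → s ∈ L → ∃[ M ] from s L ≡ s ∷ M
  from-head {s} (t ∷ L) i with s ≟ t
  ... | yes refl = L , refl
  from-head {s} (t ∷ L) (here e)  | no s≢t = contradiction e s≢t
  from-head {s} (t ∷ L) (there i) | no _   = from-head L i

  from-∈ : ∀ {s t} L → t ∈ from s L → t ∈ L
  from-∈ {s} (u ∷ L) i with s ≟ u
  ... | yes _ = i
  ... | no _  = there (from-∈ L i)

  from-related : ∀ {R : Fin n → Fin n → Set} → (∀ {s} → R s s) → ∀ {s} L → AllPairs R L →
    All (R s) (from s L)
  from-related r [] _ = []
  from-related r {s} (t ∷ L) (rs ∷ ap) with s ≟ t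
  ... | yes refl = r ∷ rs
  ... | no _     = from-related r L ap

module _ {g n : ℕ} where
  open Heap g
  open Suffixes {n}

  On-from : ∀ {c s} (f : Fin n → Bool) L → s ∈ L → On c (map f L) (suc (node c (map f (from s L))))
  On-from {s = s} f (t ∷ L) i with s ≟ t
  ... | yes _ = inj₁ refl
  On-from f (t ∷ L) (here e)  | no s≢t = contradiction e s≢t
  On-from f (t ∷ L) (there i) | no _   = inj₂ (On-from f L i)

  -- The vertices on the path carry tails of one word, of distinct lengths, so only the tail
  -- belonging to `from s L` can match.
  On-from⁻ : ∀ {c d s} (f f′ : Fin n → Bool) L → s ∈ L →
    On c (map f L) (suc (node d (map f′ (from s L)))) →
    c ≡ d × map f (from s L) ≡ map f′ (from s L)
  On-from⁻ {s = s} f f′ (t ∷ L) i o with s ≟ t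
  On-from⁻ f f′ (t ∷ L) i (inj₁ e) | yes refl
    with node-injective (map f′ (t ∷ L)) (map f (t ∷ L)) (ℕₚ.suc-injective e)
  ... | c≡d , e′ = sym c≡d , sym e′
  On-from⁻ f f′ (t ∷ L) i (inj₂ o) | yes refl = contradiction o
    (On-shorter (map f′ (t ∷ L)) (map f L)
      (s≤s (ℕₚ.≤-reflexive (trans (length-map f L) (sym (length-map f′ L))))))
  On-from⁻ f f′ (t ∷ L) (here e) o | no s≢t = contradiction e s≢t
  On-from⁻ {s = s} f f′ (t ∷ L) (there i) (inj₁ e) | no _
    with node-injective (map f′ (from s L)) (map f (t ∷ L)) (ℕₚ.suc-injective e)
  ... | _ , e′ = contradiction (from-length s L) (ℕₚ.<⇒≱ (ℕₚ.≤-reflexive (trans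
        (cong suc (sym (length-map f L))) (trans (sym (cong length e′)) (length-map f′ (from s L))))))
  On-from⁻ f f′ (t ∷ L) (there i) (inj₂ o) | no _ = On-from⁻ f f′ L i o

-- Representations from branchings

module Construction {n} (G : Graph n) (inK : Fin n → Bool) (split : IsSplitPartition G inK) {g : ℕ}
  (B : Branching G (Maximality.Stable G inK) (suc (suc (suc g)))) where

  open Maximality G inK using (Stable; _⊑_; _⊑?_)
  open Branching B renaming (branch to colour)
  open Heap (suc (suc g))
  open RootedTree parent parent-≤
  open Suffixes {n}

  -- For comparable neighbourhoods the degree decides the inclusion. Small degrees come first in
  -- `L`, and as words are read from the last letter, large neighbourhoods are treated next to the
  -- root.
  order : DecTotalOrder _ _ _
  order = On.decTotalOrder ≤-decTotalOrder (degree G)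

  unsorted = filterᵇ (not ∘ inK) (allFin n)

  L : List (Fin n)
  L = Sort.sort order unsorted

  L-complete : ∀ {s} → Stable s → s ∈ L
  L-complete {s} q = ∈-resp-↭ (↭-sym (Sort.sort-↭ order unsorted))
    (∈-filterᵇ⁺ (not ∘ inK) (∈-allFin s) (cong not q))

  L-stable : ∀ {s} → s ∈ L → Stable s
  L-stable i = not-injective (proj₂ (∈-filterᵇ⁻ (not ∘ inK) {xs = allFin n}
    (∈-resp-↭ (Sort.sort-↭ order unsorted) i)))

  L-sorted : AllPairs (λ s t → degree G s ≤ degree G t) L
  L-sorted = Sorted⇒AllPairs (DecTotalOrder.totalOrder order) (Sort.sort-↗ order unsorted)

  -- A neighbour of `s` alone, added to the neighbours of `t`, would make the degree of `s` exceed
  -- that of `t`.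
  ⊑-degree : ∀ {s t} → t ⊑ s → degree G s ≤ degree G t → s ⊑ t
  ⊑-degree {s} {t} le d k a with adj? G t k
  ... | yes b = b
  ... | no ¬b = contradiction d (ℕₚ.<⇒≱ (length-⊆
    (unique-∷ (λ i → ¬b (proj₂ (∈-filterᵇ⁻ (Graph.adj G t) {xs = allFin n} i)))
      (filterᵇ-unique (Graph.adj G t) (Uniqueₚ.allFin⁺ n))) sub))
    where
    sub : ∀ {x} → x ∈ k ∷ filterᵇ (Graph.adj G t) (allFin n) → x ∈ filterᵇ (Graph.adj G s) (allFin n)
    sub (here refl) = ∈-filterᵇ⁺ (Graph.adj G s) (∈-allFin _) a
    sub (there i)   = ∈-filterᵇ⁺ (Graph.adj G s) (∈-allFin _)
      (le _ (proj₂ (∈-filterᵇ⁻ (Graph.adj G t) {xs = allFin n} i)))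

  letterK : Fin n → Fin h → Fin n → Bool
  letterK k c t = ⌊ colour t ≟ c ⌋ ∧ Graph.adj G t k

  -- The letter at `t` in the word of each neighbour of `s`, for `t` not before `s` in `L`. It does
  -- not depend on the neighbour.
  letterS : Fin n → Fin n → Bool
  letterS s t = ⌊ colour t ≟ colour s ⌋ ∧ ⌊ s ⊑? t ⌋

  -- Let `t` have the colour of `s` and come no earlier in `L`. If `k` is adjacent to `t`, the
  -- neighbourhoods are nested, and by the degrees that of `s` is contained in that of `t`.
  letters-agree : ∀ {s k} → Stable s → Adj G s k →
    map (letterK k (colour s)) (from s L) ≡ map (letterS s) (from s L)
  letters-agree {s} {k} qs a = map-cong-local (All.tabulate agree)
    where
    agree : ∀ {t} → t ∈ from s L → letterK k (colour s) t ≡ letterS s t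
    agree {t} i with colour t ≟ colour s
    ... | no _ = refl
    ... | yes e with s ⊑? t
    ...   | yes le = le k a
    ...   | no ¬le with Graph.adj G t k in b
    ...     | false = refl
    ...     | true with nested qs (L-stable (from-∈ L i)) a b (sym e)
    ...       | inj₁ le = contradiction le ¬le
    ...       | inj₂ ge = contradiction
                    (⊑-degree ge (All.lookup (from-related ≤-refl L L-sorted) i)) ¬le

  -- When the stable neighbours of `k` have at most one colour, an unrelated second one is added:
  -- the halves of a clique path must lie in different branches.
  two-colours : ∀ k → ∃[ c ] ∃[ d ] c ≢ d ×
    (∀ {s} → Stable s → Adj G s k → c ≡ colour s ⊎ d ≡ colour s)
  two-colours k with any? (λ s → (inK s Bool.≟ false) ×-dec adj? G s k)
  ... | no ¬∃ = zero , suc zero , (λ ()) , λ qs a → ⊥-elim (¬∃ (_ , qs , a))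
  ... | yes (s , qs , as)
    with any? (λ t → (inK t Bool.≟ false) ×-dec adj? G t k ×-dec ¬? (colour s ≟ colour t))
  ...   | yes (t , qt , at , ≢) = colour s , colour t , ≢ ,
            λ qu au → only (two qs qt qu as at au)
          where
          only : ∀ {u} → colour s ≡ colour t ⊎ colour s ≡ u ⊎ colour t ≡ u →
            colour s ≡ u ⊎ colour t ≡ u
          only (inj₁ e) = contradiction e ≢
          only (inj₂ r) = r
  ...   | no ¬∃ = colour s , other (colour s) , other-≢ _ , only
          where
          only : ∀ {u} → Stable u → Adj G u k → colour s ≡ colour u ⊎ other (colour s) ≡ colour u
          only {u} qu au with colour s ≟ colour u
          ... | yes e = inj₁ e
          ... | no ≢  = ⊥-elim (¬∃ (u , qu , au , ≢))

  colour₁ colour₂ : Fin n → Fin h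
  colour₁ k = proj₁ (two-colours k)
  colour₂ k = proj₁ (proj₂ (two-colours k))

  word : Fin n → Fin h → List Bool
  word k c = map (letterK k c) L

  -- The single tree vertex representing `s`. Its word is the part, from the letter of `s` onwards,
  -- that the words of all neighbours of `s` share.
  address : Fin n → ℕ
  address s = suc (node (colour s) (map (letterS s) (from s L)))

  clique-path : Fin n → List ℕ
  clique-path k = through-root (colour₁ k) (word k (colour₁ k)) (colour₂ k) (word k (colour₂ k))

  path : Fin n → List ℕ
  path v = if inK v then clique-path v else address v ∷ []

  On-word⁺ : ∀ {k s c} → Stable s → Adj G s k → c ≡ colour s → On c (word k c) (address s)
  On-word⁺ {k} {s} qs a refl =
    subst (λ w → On (colour s) (word k (colour s)) (suc (node (colour s) w))) (letters-agree qs a)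
      (On-from (letterK k (colour s)) L (L-complete qs))

  On-word⁻ : ∀ {k s c} → Stable s → On c (word k c) (address s) → Adj G s k
  On-word⁻ {k} {s} {c} qs o with On-from⁻ (letterK k c) (letterS s) L (L-complete qs) o
                              | from-head L (L-complete qs)
  -- The words agree in particular in their first letter, that of `s` itself, and `letterS s s` is
  -- true.
  ... | refl , e | M , f = conclude (∷-injectiveˡ
      (subst (λ xs → map (letterK k (colour s)) xs ≡ map (letterS s) xs) f e))
    where
    conclude : letterK k (colour s) s ≡ letterS s s → Adj G s k
    conclude e with colour s ≟ colour s | s ⊑? s
    ... | yes _ | yes _ = e
    ... | no ≢  | _     = contradiction refl ≢
    ... | yes _ | no ¬r = contradiction (λ _ → id) ¬r

  address-∈ : ∀ {k s} → Stable s → Adj G s k ⇔ address s ∈ clique-path k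
  address-∈ {k} {s} qs = mk⇔
    (λ a → through-root⁺ (word k _) (word k _)
      ([ (λ e → inj₁ (On-word⁺ qs a e)) , (λ e → inj₂ (inj₂ (On-word⁺ qs a e))) ]′
        (proj₂ (proj₂ (proj₂ (two-colours k))) qs a)))
    (λ i → [ On-word⁻ qs , [ (λ ()) , On-word⁻ qs ]′ ]′
      (through-root⁻ (word k (colour₁ k)) (word k (colour₂ k)) i))

  -- The length of the word already determines the place of the vertex in `L`.
  address-injective : ∀ {s t} → Stable s → Stable t → address s ≡ address t → s ≡ t
  address-injective {s} {t} qs qt e
    with node-injective (map (letterS s) (from s L)) (map (letterS t) (from t L)) (ℕₚ.suc-injective e)
  ... | _ , e′ = from-length-injective L (L-complete qs) (L-complete qt)
    (trans (sym (length-map (letterS s) (from s L)))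
      (trans (cong length e′) (length-map (letterS t) (from t L))))

  top : ℕ
  top = capacity (length L)

  path-bounded : ∀ v → All (_< suc top) (path v)
  path-bounded v with inK v
  ... | false = s≤s (ℕₚ.<-≤-trans (node-< (colour v) (map (letterS v) (from v L)))
                  (capacity-mono (subst (_≤ length L) (sym (length-map (letterS v) (from v L)))
                    (from-length v L)))) ∷ []
  ... | true  = All.tabulate λ i →
      [ on (colour₁ v) , [ (λ { refl → s≤s z≤n }) , on (colour₂ v) ]′ ]′
        (through-root⁻ (word v (colour₁ v)) (word v (colour₂ v)) i)
    where
    on : ∀ c {x} → On c (word v c) x → x < suc top
    on c {x} o = subst (λ r → x < suc (capacity r)) (length-map (letterK v c) L) (On-< (word v c) o)

  path-≢[] : ∀ v → path v ≢ []
  path-≢[] v with inK v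
  ... | false = λ ()
  ... | true  = ups-≢[] (colour₁ v) (word v (colour₁ v))

  path-unique : ∀ v → Unique (path v)
  path-unique v with inK v
  ... | false = [] ∷ []
  ... | true  = through-root-unique (word v (colour₁ v)) (word v (colour₂ v))
                  (proj₁ (proj₂ (proj₂ (two-colours v))))

  path-linked : ∀ v → Linked Edge (path v)
  path-linked v with inK v
  ... | false = [-]
  ... | true  = through-root-linked (colour₁ v) (word v (colour₁ v)) (colour₂ v) (word v (colour₂ v))

  root-∈ : ∀ k → 0 ∈ clique-path k
  root-∈ k = through-root⁺ (word k (colour₁ k)) (word k (colour₂ k)) (inj₂ (inj₁ refl))

  path-correct : ∀ u v → u ≢ v → Adj G u v ⇔ ∃ λ x → x ∈ path u × x ∈ path v
  path-correct u v u≢v with inK u in eu | inK v in ev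
  ... | true  | true  = mk⇔ (λ _ → 0 , root-∈ u , root-∈ v) (λ _ → proj₂ split u v u≢v eu ev)
  ... | true  | false = mk⇔
    (λ a → _ , Equivalence.to (address-∈ ev) (trans (Graph.sym G v u) a) , here refl)
    (λ { (_ , i , here refl) → trans (Graph.sym G u v) (Equivalence.from (address-∈ ev) i) })
  ... | false | true  = mk⇔
    (λ a → _ , here refl , Equivalence.to (address-∈ eu) a)
    (λ { (_ , here refl , i) → Equivalence.from (address-∈ eu) i })
  ... | false | false = mk⇔
    (λ a → contradiction (trans (sym a) (proj₁ split u v u≢v eu ev)) λ ())
    (λ { (_ , here refl , here e) → contradiction (address-injective eu ev e) u≢v })

  construction : In[ suc (suc (suc g)) ,2,1] G
  construction = representation G top path path-bounded path-≢[] path-unique path-linked path-correct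
               , degree-≤ (s≤s (s≤s (s≤s z≤n)))

-- Colourings obtained from vertex deletions

module _ {n} (G : Graph n) where

  differ : ∀ {s t} → ¬ (s ⊑[ G ] t) → ∃[ k ] Adj G s k × ¬ Adj G t k
  differ {s} {t} ¬le with ¬∀⟶∃¬ n _ (λ k → adj? G s k →-dec adj? G t k) ¬le
  ... | k , ¬f with adj? G s k
  ...   | yes a = k , a , λ b → ¬f (λ _ → b)
  ...   | no ¬a = contradiction (λ a → contradiction a ¬a) ¬f

  -- Branch graph adjacency of stable vertices with all three witnesses in `Q`; for `Q = (_≢ v)` it
  -- survives the deletion of `v`.
  Crosses : (Fin n → Set) → Fin n → Fin n → Set
  Crosses Q s t = (∃[ k ] Q k × Adj G s k × Adj G t k) ×
    (∃[ k ] Q k × Adj G s k × ¬ Adj G t k) × (∃[ k ] Q k × Adj G t k × ¬ Adj G s k)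

-- The colours are the branches in a representation of the graph without `v`. Crossing vertices have
-- a common neighbour but are not nested, so they lie in different branches.
deletion-colouring : ∀ {n} (G : Graph n) inK (split : IsSplitPartition G inK) {h} →
  AllDeletionsIn[ suc h ,2,1] G → ∀ v → Σ (Fin n → Fin (suc h)) λ c →
    (∀ {s t} → inK s ≡ false → inK t ≡ false →
    s ≢ v → t ≢ v → Crosses G (_≢ v) s t → c s ≢ c t)
deletion-colouring {suc m} G inK split {h} deletions v = colour , proper
  where
  G′ = deleteVertex G v
  inK′ = inK ∘ punchIn v

  split′ : IsSplitPartition G′ inK′
  split′ = (λ x y x≢y → proj₁ split _ _ (x≢y ∘ punchIn-injective v x y))
         , (λ x y x≢y → proj₂ split _ _ (x≢y ∘ punchIn-injective v x y))

  open Branching (branching G′ inK′ split′ (proj₁ (deletions v)) (proj₂ (deletions v)))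

  colour : Fin (suc m) → Fin (suc h)
  colour s with v ≟ s
  -- The colour of the deleted vertex is arbitrary.
  ... | yes _  = zero
  ... | no v≢s = branch (punchOut v≢s)

  into : ∀ {x y} (v≢x : v ≢ x) (v≢y : v ≢ y) →
    Adj G x y → Adj G′ (punchOut v≢x) (punchOut v≢y)
  into v≢x v≢y = trans (cong₂ (Graph.adj G) (punchIn-punchOut v≢x) (punchIn-punchOut v≢y))

  back : ∀ {x y} (v≢x : v ≢ x) (v≢y : v ≢ y) →
    Adj G′ (punchOut v≢x) (punchOut v≢y) → Adj G x y
  back v≢x v≢y =
    trans (sym (cong₂ (Graph.adj G) (punchIn-punchOut v≢x) (punchIn-punchOut v≢y)))

  incomplete : ∀ {s t x} (v≢s : v ≢ s) (v≢x : v ≢ x) → inK s ≡ false → inK t ≡ false →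
    Adj G t x → ¬ Adj G s x → Incomplete G′ inK′ (punchOut v≢s)
  incomplete v≢s v≢x qs qt tx ¬sx = trans (cong inK (punchIn-punchOut v≢s)) qs , punchOut v≢x
    , trans (cong inK (punchIn-punchOut v≢x)) (stable-adj G inK split qt tx) , ¬sx ∘ back v≢s v≢x

  proper : ∀ {s t} → inK s ≡ false → inK t ≡ false → s ≢ v → t ≢ v →
    Crosses G (_≢ v) s t → colour s ≢ colour t
  proper {s} {t} qs qt s≢v t≢v
    ((k , k≢ , sk , tk) , (x , x≢ , sx , ¬tx) , (y , y≢ , ty , ¬sy)) e with v ≟ s | v ≟ t
  ... | yes v≡s | _       = contradiction (sym v≡s) s≢v
  ... | no _    | yes v≡t = contradiction (sym v≡t) t≢v
  ... | no v≢s  | no v≢t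
    with nested (incomplete v≢s (≢-sym y≢) qs qt ty ¬sy) (incomplete v≢t (≢-sym x≢) qt qs sx ¬tx)
           (into v≢s (≢-sym k≢) sk) (into v≢t (≢-sym k≢) tk) e
  ...   | inj₁ le = ¬tx (back v≢t (≢-sym x≢) (le _ (into v≢s (≢-sym x≢) sx)))
  ...   | inj₂ ge = ¬sy (back v≢s (≢-sym y≢) (ge _ (into v≢t (≢-sym y≢) ty)))

third : ∀ {g} (x y : Fin (suc (suc (suc g)))) → ∃[ z ] z ≢ x × z ≢ y
third x y with zero ≟ x | zero ≟ y
... | no 0≢x | no 0≢y = zero , 0≢x , 0≢y
third zero zero          | _ | _ = suc zero , (λ ()) , λ ()
third zero (suc zero)    | _ | _ = suc (suc zero) , (λ ()) , λ ()
third zero (suc (suc _)) | _ | _ = suc zero , (λ ()) , λ ()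
third (suc zero)    zero | _ | _ = suc (suc zero) , (λ ()) , λ ()
third (suc (suc _)) zero | _ | _ = suc zero , (λ ()) , λ ()
third (suc _) (suc _) | yes () | _
third (suc _) (suc _) | no _ | yes ()

-- Minimal non [h,2,1] graphs

module Minimal {n} (G : Graph n) {g : ℕ} (R : VPTRep G)
  (minimal : MinimalNon[ suc (suc (suc g)) ,2,1] G)
  (inK : Fin n → Bool) (split : IsSplitPartition G inK)
  (incomplete : ∀ {s} → inK s ≡ false → Incomplete G inK s) where

  open Maximality G inK
  open VPTRep R using (m; host)

  h : ℕ
  h = suc (suc (suc g))

  -- The given host tree has no degree bound, so its order must do; recolouring is what brings the
  -- number of branches down to `h`.
  host-degree : MaxDegree≤ host (suc m)
  host-degree x = ℕₚ.m≤n⇒m≤1+n (subst (degree host x ≤_) (length-tabulate {n = m} id)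
    (length-filter (Bool.T? ∘ Graph.adj host x) (allFin m)))

  B : Branching G Stable (suc m)
  B = record
    { branch = branch
    ; nested = λ qs qt → nested (incomplete qs) (incomplete qt)
    ; two    = λ qs qt qu → two (incomplete qs) (incomplete qt) (incomplete qu)
    }
    where open Branching (branching G inK split R host-degree)

  K-clique : ∀ {s k} → Stable s → Adj G s k → inK k ≡ true
  K-clique = stable-adj G inK split

  deleted : Fin n → Fin n → Fin h
  deleted v = proj₁ (deletion-colouring G inK split (proj₂ minimal) v)

  deleted-proper : ∀ v {s t} → Stable s → Stable t → s ≢ v → t ≢ v → Crosses G (_≢ v) s t →
    deleted v s ≢ deleted v t
  deleted-proper v = proj₂ (deletion-colouring G inK split (proj₂ minimal) v)

  -- Recolouring `B` by `c` would leave `h` branches, from which a host tree of degree at most `h`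
  -- is constructed.
  not-colourable-on-maximal : ∀ (c : Fin n → Fin h) →
    ¬ (∀ {ρ ρ′ k} → Maximal ρ → Maximal ρ′ → ρ ≢ ρ′ → Adj G ρ k → Adj G ρ′ k → c ρ ≢ c ρ′)
  not-colourable-on-maximal c proper =
    proj₁ minimal (Construction.construction G inK split (Recolour.recoloured B c proper))

  -- All witnesses are clique vertices, so the deletion of a stable vertex removes none of them.
  maximal-crosses : ∀ {v ρ ρ′ k} → Stable v → Maximal ρ → Maximal ρ′ → ρ ≢ ρ′ →
    Adj G ρ k → Adj G ρ′ k → Crosses G (_≢ v) ρ ρ′
  maximal-crosses {v} {ρ} {ρ′} qv m m′ ρ≢ρ′ a a′ =
      (_ , off (proj₁ m) a , a , a′)
    , witness m m′ ρ≢ρ′ , witness m′ m (≢-sym ρ≢ρ′)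
    where
    off : ∀ {ρ k} → Stable ρ → Adj G ρ k → k ≢ v
    off q a = K≢S G inK split (K-clique q a) qv
    witness : ∀ {ρ ρ′} → Maximal ρ → Maximal ρ′ → ρ ≢ ρ′ → ∃[ k ] k ≢ v × Adj G ρ k × ¬ Adj G ρ′ k
    witness m m′ ≢ with differ G (≢ ∘ maximal-antisym m m′)
    ... | k , a , ¬b = k , off (proj₁ m) a , a , ¬b

  -- The deletion of a vertex that is not maximal leaves all maximal ones, and its colouring would
  -- be proper on them.
  stable⇒maximal : ∀ {s} → Stable s → Maximal s
  stable⇒maximal {s} q with maximal? s
  ... | yes max = max
  ... | no ¬max = ⊥-elim (not-colourable-on-maximal (deleted s) λ m m′ ρ≢ρ′ a a′ →
          deleted-proper s (proj₁ m) (proj₁ m′) (λ { refl → ¬max m }) (λ { refl → ¬max m′ })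
            (maximal-crosses q m m′ ρ≢ρ′ a a′))

  Proper : ∀ {h} → (Fin n → Fin h) → Set
  Proper c = ∀ {s t k} → Stable s → Stable t → s ≢ t → Adj G s k → Adj G t k → c s ≢ c t

  not-proper : ∀ (c : Fin n → Fin h) → ¬ Proper c
  not-proper c proper = not-colourable-on-maximal c λ m m′ → proper (proj₁ m) (proj₁ m′)

  deleted-stable : ∀ {v s t k} → Stable v → Stable s → Stable t → s ≢ v → t ≢ v → s ≢ t →
    Adj G s k → Adj G t k → deleted v s ≢ deleted v t
  deleted-stable {v} qv qs qt s≢v t≢v s≢t a b = deleted-proper v qs qt s≢v t≢v
    (maximal-crosses qv (stable⇒maximal qs) (stable⇒maximal qt) s≢t a b)

  -- Two of three stable neighbours of `k` share a branch; being maximal, they coincide.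
  at-most-two : ∀ {s t u k} → Stable s → Stable t → Stable u → Adj G s k → Adj G t k → Adj G u k →
    s ≢ t → u ≡ s ⊎ u ≡ t
  at-most-two {s} {t} {u} qs qt qu as at au s≢t with Branching.two B qs qt qu as at au
  ... | inj₁ e        = contradiction (unique qs qt as at e) s≢t
    where
    unique : ∀ {s t k} → Stable s → Stable t → Adj G s k → Adj G t k →
      Branching.branch B s ≡ Branching.branch B t → s ≡ t
    unique qs qt = maximal-unique B (stable⇒maximal qs) (stable⇒maximal qt)
  ... | inj₂ (inj₁ e) = inj₁ (sym (maximal-unique B (stable⇒maximal qs) (stable⇒maximal qu) as au e))
  ... | inj₂ (inj₂ e) = inj₂ (sym (maximal-unique B (stable⇒maximal qt) (stable⇒maximal qu) at au e))

  -- Otherwise a colour different from those of `v` and `w` extends the colouring `deleted u` to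
  -- `u`.
  many-neighbours : ∀ {u} v w → Stable u →
    ¬ (∀ {t k} → Stable t → t ≢ u → Adj G t k → Adj G u k → t ≡ v ⊎ t ≡ w)
  many-neighbours {u} v w qu few = not-proper c proper
    where
    d = deleted u
    free = third (d v) (d w)

    c : Fin n → Fin h
    c x with x ≟ u
    ... | yes _ = proj₁ free
    ... | no _  = d x

    fresh : ∀ {t k} → Stable t → t ≢ u → Adj G t k → Adj G u k → proj₁ free ≢ d t
    fresh qt t≢u a b e with few qt t≢u a b
    ... | inj₁ refl = proj₁ (proj₂ free) e
    ... | inj₂ refl = proj₂ (proj₂ free) e

    proper : Proper c
    proper {s} {t} qs qt s≢t a b with s ≟ u | t ≟ u
    ... | yes refl | yes refl = contradiction refl s≢t
    ... | yes refl | no t≢u   = fresh qt t≢u b a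
    ... | no s≢u   | yes refl = fresh qs s≢u a b ∘ sym
    ... | no s≢u   | no t≢u   = deleted-stable qu qs qt s≢u t≢u s≢t a b

  -- Otherwise every neighbour of w in the branch graph is z or shares k with w, so there are at
  -- most two of them.
  private-neighbour : ∀ k {w z x} → Stable w → Stable z → w ≢ z → Adj G w x → Adj G z x → x ≢ k →
    ∃[ y ] y ≢ k × Adj G w y × ¬ Adj G z y
  private-neighbour k {w} {z} {x} qw qz w≢z wx zx x≢k
    with any? (λ y → ¬? (y ≟ k) ×-dec adj? G w y ×-dec ¬? (adj? G z y))
  ... | yes found = found
  ... | no ¬∃ with any? (λ t → (inK t Bool.≟ false) ×-dec ¬? (t ≟ w) ×-dec adj? G t k)
  ...   | yes (t , qt , t≢w , tk) = ⊥-elim (many-neighbours z t qw few)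
    where
    few : ∀ {u y} → Stable u → u ≢ w → Adj G u y → Adj G w y → u ≡ z ⊎ u ≡ t
    few {u} {y} qu u≢w uy wy with y ≟ k | adj? G z y
    ... | yes refl | _      = inj₂ ([ (λ e → contradiction e u≢w) , id ]′
                                (at-most-two qw qt qu wy tk uy (≢-sym t≢w)))
    ... | no _     | yes zy = inj₁ ([ (λ e → contradiction e u≢w) , id ]′
                                (at-most-two qw qz qu wy zy uy w≢z))
    ... | no y≢k   | no ¬zy = ⊥-elim (¬∃ (y , y≢k , wy , ¬zy))
  ...   | no ¬t = ⊥-elim (many-neighbours z z qw few)
    where
    few : ∀ {u y} → Stable u → u ≢ w → Adj G u y → Adj G w y → u ≡ z ⊎ u ≡ z
    few {u} {y} qu u≢w uy wy with y ≟ k | adj? G z y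
    ... | yes refl | _      = ⊥-elim (¬t (u , qu , u≢w , uy))
    ... | no _     | yes zy = inj₁ ([ (λ e → contradiction e u≢w) , id ]′
                                (at-most-two qw qz qu wy zy uy w≢z))
    ... | no y≢k   | no ¬zy = ⊥-elim (¬∃ (y , y≢k , wy , ¬zy))

  -- Without `k` the common neighbour `x` is left, and so is a private neighbour of each of the two
  -- vertices.
  deleted-clique : ∀ {k w z x} → inK k ≡ true → Stable w → Stable z → w ≢ z →
    Adj G w x → Adj G z x → x ≢ k → deleted k w ≢ deleted k z
  deleted-clique {k} qk qw qz w≢z wx zx x≢k = deleted-proper k qw qz
    (≢-sym (K≢S G inK split qk qw)) (≢-sym (K≢S G inK split qk qz))
    ( (_ , x≢k , wx , zx)
    , private-neighbour k qw qz w≢z wx zx x≢k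
    , private-neighbour k qz qw (≢-sym w≢z) zx wx x≢k)

  -- If no pair of stable vertices meets at `k`, every pair keeps its common neighbours when `k` is
  -- deleted, and `deleted k` would be proper.
  two-neighbours : ∀ {k} → inK k ≡ true →
    ∃[ s ] ∃[ t ] Stable s × Stable t × s ≢ t × Adj G s k × Adj G t k
  two-neighbours {k} qk
    with any? (λ s → any? (λ t → (inK s Bool.≟ false) ×-dec (inK t Bool.≟ false) ×-dec
      ¬? (s ≟ t) ×-dec adj? G s k ×-dec adj? G t k))
  ... | yes found = found
  ... | no ¬∃ = ⊥-elim (not-proper (deleted k) λ qs qt s≢t a b →
          deleted-clique qk qs qt s≢t a b λ { refl → ¬∃ (_ , _ , qs , qt , s≢t , a , b) })

  -- The only pair meeting at `k` is that of `s` and `t`. If it also meets at `k′`, the deletion of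
  -- `k` separates no pair and `deleted k` would be proper.
  pair-determines : ∀ {s t k k′} → Stable s → Stable t → s ≢ t → Adj G s k → Adj G t k →
    Adj G s k′ → Adj G t k′ → k ≡ k′
  pair-determines {s} {t} {k} {k′} qs qt s≢t sk tk sk′ tk′ with k ≟ k′
  ... | yes e = e
  ... | no k≢k′ = ⊥-elim (not-proper (deleted k) proper)
    where
    moved : ∀ {u} → Stable u → Adj G u k → Adj G u k′
    moved qu uk with at-most-two qs qt qu sk tk uk s≢t
    ... | inj₁ refl = sk′
    ... | inj₂ refl = tk′
    proper : Proper (deleted k)
    proper {k = x} qu qv u≢v ux vx with x ≟ k
    ... | no x≢k   = deleted-clique (K-clique qs sk) qu qv u≢v ux vx x≢k
    ... | yes refl =
      deleted-clique (K-clique qs sk) qu qv u≢v (moved qu ux) (moved qv vx) (≢-sym k≢k′)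

-- Reading the boolean definitions

∧-true : ∀ {x y} → x ≡ true → y ≡ true → x ∧ y ≡ true
∧-true refl refl = refl

not-true : ∀ {b} → ¬ b ≡ true → not b ≡ true
not-true {false} _  = refl
not-true {true}  ¬t = contradiction refl ¬t

any-sound : ∀ {A : Set} (p : A → Bool) xs → any p xs ≡ true → ∃[ x ] p x ≡ true
any-sound p (x ∷ xs) e with p x in f
... | true  = x , f
... | false = any-sound p xs e

any-complete : ∀ {A : Set} (p : A → Bool) {x xs} → x ∈ xs → p x ≡ true → any p xs ≡ true
any-complete p (here refl) e rewrite e = refl
any-complete p {xs = y ∷ _} (there i) e rewrite any-complete p i e = ∨-zeroʳ (p y)

==-refl : ∀ {n} (x : Fin n) → (x == x) ≡ true
==-refl x with x ≟ x
... | yes _ = refl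
... | no ≢  = contradiction refl ≢

==-≢ : ∀ {n} {x y : Fin n} → not (x == y) ≡ true → x ≢ y
==-≢ {x = x} e refl rewrite ==-refl x with () ← e

==-pair : ∀ {n} {u v x y : Fin n} → not ((x == u ∧ y == v) ∨ (x == v ∧ y == u)) ≡ true →
  ¬ (x ≡ u × y ≡ v) × ¬ (x ≡ v × y ≡ u)
==-pair {u = u} {v} {x} {y} e = first e , second e
  where
  first : not ((x == u ∧ y == v) ∨ (x == v ∧ y == u)) ≡ true → ¬ (x ≡ u × y ≡ v)
  first e (refl , refl) rewrite ==-refl x | ==-refl y with () ← e
  second : not ((x == u ∧ y == v) ∨ (x == v ∧ y == u)) ≡ true → ¬ (x ≡ v × y ≡ u)
  second e (refl , refl) rewrite ==-refl x | ==-refl y | ∨-zeroʳ (x == u ∧ y == v) with () ← e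

-- Edges and criticality of the branch graph

module Conclusion {n} (G : Graph n) {g : ℕ} (R : VPTRep G)
  (minimal : MinimalNon[ suc (suc (suc g)) ,2,1] G)
  (inK : Fin n → Bool) (split : IsSplitPartition G inK)
  (incomplete : ∀ {s} → inK s ≡ false → Incomplete G inK s) where

  open Maximality G inK
  open Minimal G R minimal inK split incomplete

  H = branchGraph G inK
  open SubGraph H using (V; E)

  adj-comm : ∀ {u v} → Adj G u v → Adj G v u
  adj-comm {u} {v} = trans (Graph.sym G v u)

  neighbours-two : ∀ k → inK k ≡ true → neighboursIn G (not ∘ inK) k ≡ 2
  neighbours-two k qk with two-neighbours qk
  ... | s , t , qs , qt , s≢t , sk , tk = ℕₚ.≤-antisym
      (length-⊆ (filterᵇ-unique stable-neighbour (Uniqueₚ.allFin⁺ n)) within)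
      (length-⊆ ((s≢t ∷ []) ∷ [] ∷ []) around)
    where
    stable-neighbour : Fin n → Bool
    stable-neighbour x = Graph.adj G k x ∧ not (inK x)

    within : ∀ {x} → x ∈ filterᵇ stable-neighbour (allFin n) → x ∈ s ∷ t ∷ []
    within {x} i with proj₂ (∈-filterᵇ⁻ stable-neighbour {xs = allFin n} i)
    ... | e with at-most-two qs qt (not-injective (∧-conicalʳ _ _ e)) sk tk
                   (adj-comm (∧-conicalˡ _ _ e)) s≢t
    ...   | inj₁ x≡s = here x≡s
    ...   | inj₂ x≡t = there (here x≡t)

    around : ∀ {x} → x ∈ s ∷ t ∷ [] → x ∈ filterᵇ stable-neighbour (allFin n)
    around (here refl)         = ∈-filterᵇ⁺ stable-neighbour (∈-allFin s)
                                   (∧-true (adj-comm sk) (cong not qs))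
    around (there (here refl)) = ∈-filterᵇ⁺ stable-neighbour (∈-allFin t)
                                   (∧-true (adj-comm tk) (cong not qt))

  -- This is adjacency in the branch graph: as all stable vertices are maximal, distinct ones have
  -- private neighbours anyway.
  Meet : Fin n → Fin n → Set
  Meet s t = Stable s × Stable t × s ≢ t × ∃[ k ] Adj G s k × Adj G t k

  V-stable : ∀ {v} → V v ≡ true → Stable v
  V-stable e = not-injective (∧-conicalˡ _ _ e)

  E-meet : ∀ {s t} → V s ≡ true → V t ≡ true → E s t ≡ true → Meet s t
  E-meet {s} {t} vs vt e with ∧-conicalʳ (not (Graph.adj G s t)) _ e
  ... | e₁ with any-sound _ (allFin n) (∧-conicalˡ _ _ e₁)
              | any-sound _ (allFin n) (∧-conicalˡ _ _ (∧-conicalʳ (any _ (allFin n)) _ e₁))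
  ...   | k , f | y , f′ = V-stable vs , V-stable vt , distinct (∧-conicalʳ (inK y) _ f′) , k
          , adj-comm (∧-conicalˡ _ _ (∧-conicalʳ (inK k) _ f))
          , adj-comm (∧-conicalʳ _ _ (∧-conicalʳ (inK k) _ f))
    where
    distinct : Graph.adj G y s ∧ not (Graph.adj G y t) ≡ true → s ≢ t
    distinct f refl with Graph.adj G y s
    distinct () refl | true
    distinct () refl | false

  meet-V : ∀ {s t} → Meet s t → V s ≡ true
  meet-V {s} (qs , _ , _ , k , sk , _) = ∧-true (cong not qs)
    (any-complete (λ x → inK x ∧ Graph.adj G x s) (∈-allFin k)
      (∧-true (K-clique qs sk) (adj-comm sk)))

  meet-sym : ∀ {s t} → Meet s t → Meet t s
  meet-sym (qs , qt , s≢t , k , sk , tk) = qt , qs , ≢-sym s≢t , k , tk , sk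

  meet-E : ∀ {s t} → Meet s t → E s t ≡ true
  meet-E {s} {t} (qs , qt , s≢t , k , sk , tk) = ∧-true (cong not (proj₁ split s t s≢t qs qt))
    (∧-true (any-complete _ (∈-allFin k)
        (∧-true (K-clique qs sk) (∧-true (adj-comm sk) (adj-comm tk))))
      (∧-true (difference qs qt s≢t) (difference qt qs (≢-sym s≢t))))
    where
    difference : ∀ {s t} → Stable s → Stable t → s ≢ t →
      any (λ y → inK y ∧ Graph.adj G y s ∧ not (Graph.adj G y t)) (allFin n) ≡ true
    difference qs qt s≢t with differ G (s≢t ∘ maximal-antisym (stable⇒maximal qs) (stable⇒maximal qt))
    ... | y , a , ¬b = any-complete _ (∈-allFin y)
            (∧-true (K-clique qs a) (∧-true (adj-comm a) (not-true (¬b ∘ adj-comm))))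

  edgeᵇ : Fin n × Fin n → Bool
  edgeᵇ p = (toℕ (proj₁ p) ℕ.<ᵇ toℕ (proj₂ p)) ∧ V (proj₁ p) ∧ V (proj₂ p) ∧ E (proj₁ p) (proj₂ p)

  pairs = cartesianProduct (allFin n) (allFin n)

  ∈-edges⁻ : ∀ {u v} → (u , v) ∈ filterᵇ edgeᵇ pairs → toℕ u ℕ.< toℕ v × Meet u v
  ∈-edges⁻ {u} {v} i with proj₂ (∈-filterᵇ⁻ edgeᵇ {xs = pairs} i)
  ... | e with ∧-conicalʳ (toℕ u ℕ.<ᵇ toℕ v) _ e
  ...   | e₁ with ∧-conicalʳ (V u) _ e₁
  ...     | e₂ = ℕₚ.<ᵇ⇒< (toℕ u) (toℕ v) (Equivalence.from T-≡ (∧-conicalˡ (toℕ u ℕ.<ᵇ toℕ v) _ e))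
               , E-meet (∧-conicalˡ (V u) _ e₁) (∧-conicalˡ (V v) _ e₂) (∧-conicalʳ (V v) _ e₂)

  ∈-edges⁺ : ∀ {u v} → toℕ u ℕ.< toℕ v → Meet u v → (u , v) ∈ filterᵇ edgeᵇ pairs
  ∈-edges⁺ {u} {v} lt meet = ∈-filterᵇ⁺ edgeᵇ (∈-cartesianProduct⁺ (∈-allFin u) (∈-allFin v))
    (∧-true (Equivalence.to T-≡ (ℕₚ.<⇒<ᵇ lt))
      (∧-true (meet-V meet) (∧-true (meet-V (meet-sym meet)) (meet-E meet))))

  Ends : Fin n × Fin n → Fin n → Set
  Ends (u , v) k = Adj G u k × Adj G v k

  ends-unique : ∀ {p p′ k} → p ∈ filterᵇ edgeᵇ pairs → p′ ∈ filterᵇ edgeᵇ pairs →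
    Ends p k → Ends p′ k → p ≡ p′
  ends-unique {u , v} {u′ , v′} i i′ (uk , vk) (u′k , v′k) with ∈-edges⁻ i | ∈-edges⁻ i′
  ... | u<v , qu , qv , u≢v , _ | u′<v′ , qu′ , qv′ , u′≢v′ , _
    with at-most-two qu qv qu′ uk vk u′k u≢v | at-most-two qu qv qv′ uk vk v′k u≢v
  ... | inj₁ refl | inj₁ refl = contradiction refl u′≢v′
  ... | inj₁ refl | inj₂ refl = refl
  ... | inj₂ refl | inj₁ refl = contradiction u<v (ℕₚ.<-asym u′<v′)
  ... | inj₂ refl | inj₂ refl = contradiction refl u′≢v′

  -- `Ends` matches edges with clique vertices: an edge has exactly one common neighbour, and a
  -- clique vertex has exactly two stable neighbours, which form an edge.
  edges-size : numEdges H ≡ size inK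
  edges-size = ℕₚ.≤-antisym
    (length-≤ Ends
      (filterᵇ-unique edgeᵇ
        (Uniqueₚ.cartesianProduct⁺ (Uniqueₚ.allFin⁺ n) (Uniqueₚ.allFin⁺ n)))
      common ends-unique)
    -- Membership of `p` is made part of the relation because `pair-determines` needs `p` to be an
    -- edge.
    (length-≤ (λ k p → p ∈ filterᵇ edgeᵇ pairs × Ends p k)
      (filterᵇ-unique inK (Uniqueₚ.allFin⁺ n))
      (λ i → let p , j , e = ends i in p , j , j , e) (λ _ _ → determined))
    where
    common : ∀ {p} → p ∈ filterᵇ edgeᵇ pairs → ∃[ k ] k ∈ filterᵇ inK (allFin n) × Ends p k
    common {u , v} i with ∈-edges⁻ i
    ... | _ , qu , _ , _ , k , uk , vk = k , ∈-filterᵇ⁺ inK (∈-allFin k) (K-clique qu uk) , uk , vk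

    ends : ∀ {k} → k ∈ filterᵇ inK (allFin n) → ∃[ p ] p ∈ filterᵇ edgeᵇ pairs × Ends p k
    ends {k} i with two-neighbours (proj₂ (∈-filterᵇ⁻ inK {xs = allFin n} i))
    ... | s , t , qs , qt , s≢t , sk , tk with Finₚ.<-cmp s t
    ...   | tri< lt _ _ = (s , t) , ∈-edges⁺ lt (qs , qt , s≢t , k , sk , tk) , sk , tk
    ...   | tri≈ _ e _  = contradiction e s≢t
    ...   | tri> _ _ gt = (t , s) , ∈-edges⁺ gt (qt , qs , ≢-sym s≢t , k , tk , sk) , tk , sk

    determined : ∀ {k k′ p} → p ∈ filterᵇ edgeᵇ pairs × Ends p k →
      p ∈ filterᵇ edgeᵇ pairs × Ends p k′ → k ≡ k′
    determined (i , uk , vk) (_ , uk′ , vk′) with ∈-edges⁻ i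
    ... | _ , qu , qv , u≢v , _ = pair-determines qu qv u≢v uk vk uk′ vk′

  colourable⇒proper : ∀ {j} ((c , _) : Colorable H j) → Proper c
  colourable⇒proper (c , ok) qs qt s≢t a b =
    ok _ _ (meet-V meet) (meet-V (meet-sym meet)) (meet-E meet)
    where meet = qs , qt , s≢t , _ , a , b

  stable-exists : ∃ Stable
  stable-exists with any? (λ s → inK s Bool.≟ false)
  ... | yes found = found
  ... | no ¬∃     = ⊥-elim (not-proper (λ _ → zero) λ {s} qs → ⊥-elim (¬∃ (s , qs)))

  -- One stable vertex takes the additional colour; the others keep the `h` colours they have after
  -- its deletion.
  colourable : Colorable H (suc h)
  colourable with stable-exists
  ... | s , qs = c , λ u v vu vv e → ok (E-meet vu vv e)
    where
    c : Fin n → Fin (suc h)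
    c x with x ≟ s
    ... | yes _ = zero
    ... | no _  = suc (deleted s x)

    ok : ∀ {u v} → Meet u v → c u ≢ c v
    ok {u} {v} (qu , qv , u≢v , _ , a , b) e with u ≟ s | v ≟ s
    ... | yes refl | yes refl = u≢v refl
    ... | yes refl | no _     with () ← e
    ... | no _     | yes refl with () ← e
    ... | no u≢s   | no v≢s   = deleted-stable qs qu qv u≢s v≢s u≢v a b (suc-injective e)

  not-colourable : ∀ j → j ℕ.< suc h → ¬ Colorable H j
  not-colourable j (s≤s j≤h) col = not-proper (λ x → inject≤ (proj₁ col x) j≤h)
    λ qs qt s≢t a b → colourable⇒proper col qs qt s≢t a b ∘ inject≤-injective j≤h j≤h _ _

  vertex-critical : ∀ v → V v ≡ true → ChromaticNumber< (deleteV H v) (suc h)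
  vertex-critical v vv = h , ℕₚ.≤-refl , deleted v , λ x y vx vy e →
    let qx , qy , x≢y , _ , a , b = E-meet (∧-conicalˡ _ _ vx) (∧-conicalˡ _ _ vy) e
    in deleted-stable (V-stable vv) qx qy
         (==-≢ (∧-conicalʳ (V x) _ vx)) (==-≢ (∧-conicalʳ (V y) _ vy)) x≢y a b

  -- Let `k` be the common neighbour of `u` and `v`. The colouring `deleted k` can fail only on
  -- pairs that meet nowhere but at `k`, and no edge other than the deleted one meets there.
  edge-critical : ∀ u v → V u ≡ true → V v ≡ true → E u v ≡ true →
    ChromaticNumber< (deleteE H u v) (suc h)
  edge-critical u v vu vv e with E-meet vu vv e
  ... | qu , qv , u≢v , k , uk , vk = h , ℕₚ.≤-refl , deleted k , ok
    where
    other-edge : ∀ {x y} → Meet x y → Adj G x k → Adj G y k → (x ≡ u × y ≡ v) ⊎ (x ≡ v × y ≡ u)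
    other-edge (qx , qy , x≢y , _) xk yk
      with at-most-two qu qv qx uk vk xk u≢v | at-most-two qu qv qy uk vk yk u≢v
    ... | inj₁ refl | inj₁ refl = contradiction refl x≢y
    ... | inj₁ refl | inj₂ refl = inj₁ (refl , refl)
    ... | inj₂ refl | inj₁ refl = inj₂ (refl , refl)
    ... | inj₂ refl | inj₂ refl = contradiction refl x≢y

    ok : ∀ x y → V x ≡ true → V y ≡ true → SubGraph.E (deleteE H u v) x y ≡ true →
      deleted k x ≢ deleted k y
    ok x y vx vy e′
      with E-meet vx vy (∧-conicalˡ (E x y) _ e′)
         | ==-pair {u = u} {v} {x} {y} (∧-conicalʳ (E x y) _ e′)
    ... | meet@(qx , qy , x≢y , l , xl , yl) | ¬first , ¬second with l ≟ k
    ...   | no l≢k   = deleted-clique (K-clique qu uk) qx qy x≢y xl yl l≢k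
    ...   | yes refl = ⊥-elim ([ ¬first , ¬second ]′ (other-edge meet xl yl))

  conclusion : (∀ k → inK k ≡ true → neighboursIn G (not ∘ inK) k ≡ 2) ×
    numEdges H ≡ size inK × IsCritical (suc h) H
  conclusion =
    neighbours-two , edges-size , (colourable , not-colourable) , vertex-critical , edge-critical

-- Stable vertices joined to the whole clique

incomplete? : ∀ {n} (G : Graph n) inK →
  (∃[ s ] inK s ≡ false × ∀ k → inK k ≡ true → Adj G s k) ⊎
  (∀ {s} → inK s ≡ false → Incomplete G inK s)
incomplete? {n} G inK
  with any? (λ s → (inK s Bool.≟ false) ×-dec
    all? (λ k → (inK k Bool.≟ true) →-dec adj? G s k))
... | yes found = inj₁ found
... | no ¬∃ = inj₂ incomplete
  where
  incomplete : ∀ {s} → inK s ≡ false → Incomplete G inK s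
  incomplete {s} q with any? (λ k → (inK k Bool.≟ true) ×-dec ¬? (adj? G s k))
  ... | yes found = q , found
  ... | no ¬k = ⊥-elim (¬∃ (s , q , complete))
    where
    complete : ∀ k → inK k ≡ true → Adj G s k
    complete k qk with adj? G s k
    ... | yes a = a
    ... | no ¬a = ⊥-elim (¬k (k , qk , ¬a))

-- A stable vertex s joined to the whole clique could be moved into it, where it would have no
-- stable neighbour left.
no-complete : ∀ {n} (G : Graph n) {g} → VPTRep G → MinimalNon[ suc (suc (suc g)) ,2,1] G →
  ∀ inK → IsSplitPartition G inK → ¬ (∃[ s ] inK s ≡ false × ∀ k → inK k ≡ true → Adj G s k)
no-complete {n} G R minimal inK split (s , qs , complete) = isolated (two-neighbours in-s)
  where
  inK′ : Fin n → Bool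
  inK′ x = inK x ∨ (x == s)

  in-s : inK′ s ≡ true
  in-s = trans (cong (inK s ∨_) (==-refl s)) (∨-zeroʳ (inK s))

  stable′ : ∀ {x} → inK′ x ≡ false → inK x ≡ false × x ≢ s
  stable′ {x} e with inK x | x ≟ s
  ... | false | no x≢s = refl , x≢s

  clique′ : ∀ {x} → inK′ x ≡ true → inK x ≡ true ⊎ x ≡ s
  clique′ {x} e with inK x | x ≟ s
  ... | true  | _     = inj₁ refl
  ... | false | yes p = inj₂ p

  split′ : IsSplitPartition G inK′
  split′ = (λ u v u≢v qu qv → proj₁ split u v u≢v (proj₁ (stable′ qu)) (proj₁ (stable′ qv)))
         , λ u v u≢v qu qv → joined u≢v (clique′ qu) (clique′ qv)
    where
    joined : ∀ {u v} → u ≢ v → inK u ≡ true ⊎ u ≡ s → inK v ≡ true ⊎ v ≡ s → Graph.adj G u v ≡ true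
    joined u≢v (inj₁ qu)   (inj₁ qv)   = proj₂ split _ _ u≢v qu qv
    joined u≢v (inj₁ qu)   (inj₂ refl) = trans (Graph.sym G _ s) (complete _ qu)
    joined u≢v (inj₂ refl) (inj₁ qv)   = complete _ qv
    joined u≢v (inj₂ refl) (inj₂ refl) = contradiction refl u≢v

  apart : ∀ {t} → inK′ t ≡ false → ¬ Adj G t s
  apart {t} qt a = contradiction
    (trans (sym a) (proj₁ split t s (proj₂ (stable′ qt)) (proj₁ (stable′ qt)) qs)) λ ()

  open Minimal G R minimal inK′ split′ (λ qt → qt , s , in-s , apart qt) using (two-neighbours)

  isolated : ¬ (∃[ u ] ∃[ v ] inK′ u ≡ false × inK′ v ≡ false × u ≢ v × Adj G u s × Adj G v s)
  isolated (_ , _ , qu , _ , _ , us , _) = apart qu us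

theorem16 : ∀ {n} (G : Graph n) (h : ℕ) → 3 ≤ h → Connected G → IsVPT G →
    MinimalNon[ h ,2,1] G →
    (inK : Fin n → Bool) → IsSplitPartition G inK →
    (∀ k → inK k ≡ true → neighboursIn G (λ x → not (inK x)) k ≡ 2) ×
    (numEdges (branchGraph G inK) ≡ size inK) ×
    IsCritical (suc h) (branchGraph G inK)
theorem16 G _ (s≤s (s≤s (s≤s z≤n))) _ R minimal inK split with incomplete? G inK
... | inj₁ found      = ⊥-elim (no-complete G R minimal inK split found)
... | inj₂ incomplete = Conclusion.conclusion G R minimal inK split incomplete
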